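{- Let $\lambda\in\mathbb{R}\setminus\{0\}$, $k\in\mathbb{Z}$, $u\in\mathbb{C}$ with $u\neq1$, and $x_1,x_2,y\in\mathbb{R}$. Then for every integer $n\ge0$, \[ FG_{n,\lambda}^{[k,c]}(x_1+x_2,y;u)=\sum_{m=0}^{n}\binom{n}{m}\sum_{r=0}^{m}S_{2,\lambda}^{(x_1)}(m,r)\,(x_2)_r\,FG_{n-m,\lambda}^{[k,c]}(0,y;u) \] and \[ FG_{n,\lambda}^{[k,s]}(x_1+x_2,y;u)=\sum_{m=0}^{n}\binom{n}{m}\sum_{r=0}^{m}S_{2,\lambda}^{(x_1)}(m,r)\,(x_2)_r\,FG_{n-m,\lambda}^{[k,s]}(0,y;u). \]
   Context: All generating functions are formal power series in $t$. For $z\in\mathbb{C}$: $(z)_{0,\lambda}=1$ and $(z)_{n,\lambda}=z(z-\lambda)\cdots(z-(n-1)\lambda)$ for $n\ge1$; $(z)_0=1$ and $(z)_r=z(z-1)\cdots(z-r+1)$ is the ordinary falling factorial. The degenerate exponential is $e_\lambda^{z}(t)=\sum_{n\ge0}(z)_{n,\lambda}\frac{t^n}{n!}$ (i.e. $(1+\lambda t)^{z/\lambda}$), and $e_\lambda(t)=e_\lambda^{1}(t)$. Also $\log_\lambda(1+t)=\frac{1}{\lambda}\big((1+t)^\lambda-1\big)$. The degenerate $\lambda$-Stirling polynomials of the second kind are defined by $\frac{(e_\lambda(t)-1)^r}{r!}e_\lambda^{x}(t)=\sum_{n\ge r}S_{2,\lambda}^{(x)}(n,r)\frac{t^n}{n!}$.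 The modified degenerate polyexponential function is $\mathrm{Ei}_{k,\lambda}(x)=\sum_{n\ge1}\frac{(1)_{n,\lambda}}{n^k(n-1)!}x^n$. The degenerate cosine and sine are $\cos_\lambda^{(y)}(t)=\frac{e_\lambda^{iy}(t)+e_\lambda^{ -iy}(t)}{2}$ and $\sin_\lambda^{(y)}(t)=\frac{e_\lambda^{iy}(t)-e_\lambda^{ -iy}(t)}{2i}$. The cosine and sine degenerate poly-Frobenius-Genocchi polynomials are defined by $\sum_{n\ge0}FG_{n,\lambda}^{[k,c]}(x,y;u)\frac{t^n}{n!}=\frac{(1-u)\mathrm{Ei}_{k,\lambda}(\log_\lambda(1+t))}{e_\lambda(t)-u}e_\lambda^{x}(t)\cos_\lambda^{(y)}(t)$ and $\sum_{n\ge0}FG_{n,\lambda}^{[k,s]}(x,y;u)\frac{t^n}{n!}=\frac{(1-u)\mathrm{Ei}_{k,\lambda}(\log_\lambda(1+t))}{e_\lambda(t)-u}e_\lambda^{x}(t)\sin_\lambda^{(y)}(t)$. -}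

module Defs where

open import Algebra.Bundles.Raw using (RawRing)
import Algebra.Definitions.RawSemiring as RawSemiringDefs
open import Data.Fin.Base using (toℕ)
open import Data.Integer.Base as ℤ using (ℤ; +_; -[1+_])
open import Data.Nat.Base as ℕ using (ℕ; zero; suc; _∸_; _!)
import Data.Nat.Properties as ℕ
open import Data.Product.Base using (Σ-syntax; ∃-syntax; _×_; _,_)
open import Data.Rational.Base as ℚ using (ℚ; 0ℚ; 1ℚ; ½; ∣_∣)
import Data.Rational.Properties as ℚ
open import Data.Rational.Solver using (module +-*-Solver)
open import Data.Sum.Base using (_⊎_; inj₁; inj₂)
open import Data.Vec.Base using (Vec; []; _∷_; head; lookup)
open import Level using (0ℓ)
open import Relation.Binary.PropositionalEquality using (_≡_; refl; sym; trans; cong; cong₂; subst)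
open import Relation.Nullary using (yes; no; contradiction)
open import Relation.Nullary.Decidable using (toWitness)

-- Real numbers: Cauchy sequences of rationals, with equality _≈ᴿ_
-- identifying sequences whose difference tends to 0.

IsCauchy : (ℕ → ℚ) → Set
IsCauchy s = ∀ ε → 0ℚ ℚ.< ε →
  ∃[ N ] (∀ m n → N ℕ.≤ m → N ℕ.≤ n → ∣ s m ℚ.- s n ∣ ℚ.< ε)

record ℝ : Set where
  no-eta-equality
  field
    seq    : ℕ → ℚ
    cauchy : IsCauchy seq

open ℝ public

infix 4 _≈ᴿ_ _#ᴿ_

record _≈ᴿ_ (x y : ℝ) : Set where
  constructor mk≈
  field
    tendsto : ∀ ε → 0ℚ ℚ.< ε →
      ∃[ N ] (∀ n → N ℕ.≤ n → ∣ seq x n ℚ.- seq y n ∣ ℚ.< ε)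

-- Apartness: the positive form of x ≠ y, needed to divide by x - y.
-- For Cauchy sequences it is classically equivalent to the negation of x ≈ᴿ y.
record _#ᴿ_ (x y : ℝ) : Set where
  constructor mk#
  field
    gap    : ℚ
    0<gap  : 0ℚ ℚ.< gap
    from   : ℕ
    gap≤   : ∀ n → from ℕ.≤ n → gap ℚ.≤ ∣ seq x n ℚ.- seq y n ∣

open +-*-Solver using (solve; _:+_; _:*_; _:-_; :-_; _:=_; con)

module CauchyLemmas where

  0<1 : 0ℚ ℚ.< 1ℚ
  0<1 = toWitness {a? = 0ℚ ℚ.<? 1ℚ} _

  0<½* : ∀ {ε} → 0ℚ ℚ.< ε → 0ℚ ℚ.< ½ ℚ.* ε
  0<½* {ε} 0<ε = subst (ℚ._< ½ ℚ.* ε) (ℚ.*-zeroʳ ½) (ℚ.*-monoʳ-<-pos ½ 0<ε)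

  0<* : ∀ {p q} → 0ℚ ℚ.< p → 0ℚ ℚ.< q → 0ℚ ℚ.< p ℚ.* q
  0<* {p} {q} 0<p 0<q =
    subst (ℚ._< p ℚ.* q) (ℚ.*-zeroʳ p) (ℚ.*-monoʳ-<-pos p {{ℚ.positive 0<p}} 0<q)

  ½*+½* : ∀ ε → ½ ℚ.* ε ℚ.+ ½ ℚ.* ε ≡ ε
  ½*+½* ε = trans (sym (ℚ.*-distribʳ-+ ε ½ ½)) (ℚ.*-identityˡ ε)

  divide : ∀ {b} → 0ℚ ℚ.< b → ∀ {ε} → 0ℚ ℚ.< ε → Σ[ δ ∈ ℚ ] 0ℚ ℚ.< δ × b ℚ.* δ ≡ ε
  divide {b} 0<b {ε} 0<ε = 1/b ℚ.* ε , 0<δ , b*δ≡ε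
    where
    instance
      b≢0 : ℚ.NonZero b
      b≢0 = ℚ.>-nonZero 0<b
      b>0 : ℚ.Positive b
      b>0 = ℚ.positive 0<b
    1/b = ℚ.1/ b
    instance
      1/b>0 : ℚ.Positive 1/b
      1/b>0 = ℚ.1/pos⇒pos b
    0<δ = subst (ℚ._< 1/b ℚ.* ε) (ℚ.*-zeroʳ 1/b) (ℚ.*-monoʳ-<-pos 1/b 0<ε)
    b*δ≡ε = trans (sym (ℚ.*-assoc b 1/b ε))
              (trans (cong (ℚ._* ε) (ℚ.*-inverseʳ b)) (ℚ.*-identityˡ ε))

  *-mono-≤-abs : ∀ p q {b c} → 0ℚ ℚ.≤ b → ∣ p ∣ ℚ.≤ b → ∣ q ∣ ℚ.≤ c → ∣ p ℚ.* q ∣ ℚ.≤ b ℚ.* c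
  *-mono-≤-abs p q {b} {c} 0≤b p≤b q≤c = begin
    ∣ p ℚ.* q ∣       ≡⟨ ℚ.∣p*q∣≡∣p∣*∣q∣ p q ⟩
    ∣ p ∣ ℚ.* ∣ q ∣   ≤⟨ ℚ.*-monoʳ-≤-nonNeg ∣ q ∣ {{ℚ.nonNegative (ℚ.0≤∣p∣ q)}} p≤b ⟩
    b ℚ.* ∣ q ∣       ≤⟨ ℚ.*-monoˡ-≤-nonNeg b {{ℚ.nonNegative 0≤b}} q≤c ⟩
    b ℚ.* c           ∎
    where open ℚ.≤-Reasoning

  EventuallyBounded : (ℕ → ℚ) → Set
  EventuallyBounded s = Σ[ b ∈ ℚ ] 0ℚ ℚ.< b × ∃[ N ] (∀ n → N ℕ.≤ n → ∣ s n ∣ ℚ.≤ b)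

  bounded : ∀ s → IsCauchy s → EventuallyBounded s
  bounded s cs with cs 1ℚ 0<1
  ... | N , close = 1ℚ ℚ.+ ∣ s N ∣ , 0<b , N , bound
    where
    open ℚ.≤-Reasoning
    0<b = ℚ.+-mono-<-≤ 0<1 (ℚ.0≤∣p∣ (s N))
    bound : ∀ n → N ℕ.≤ n → ∣ s n ∣ ℚ.≤ 1ℚ ℚ.+ ∣ s N ∣
    bound n N≤n = begin
      ∣ s n ∣
        ≡⟨ cong ∣_∣ (solve 2 (λ a b → a := (a :- b) :+ b) refl (s n) (s N)) ⟩
      ∣ (s n ℚ.- s N) ℚ.+ s N ∣
        ≤⟨ ℚ.∣p+q∣≤∣p∣+∣q∣ (s n ℚ.- s N) (s N) ⟩
      ∣ s n ℚ.- s N ∣ ℚ.+ ∣ s N ∣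
        ≤⟨ ℚ.+-monoˡ-≤ ∣ s N ∣ (ℚ.<⇒≤ (close n N N≤n ℕ.≤-refl)) ⟩
      1ℚ ℚ.+ ∣ s N ∣ ∎

  -- A sequence whose increments are dominated by those of two Cauchy sequences.
  module Dominated (r s t : ℕ → ℚ) (cr : IsCauchy r) (cs : IsCauchy s)
    {a b : ℚ} (0<a : 0ℚ ℚ.< a) (0<b : 0ℚ ℚ.< b) (N₀ : ℕ)
    (dom : ∀ m n → N₀ ℕ.≤ m → N₀ ℕ.≤ n →
      ∣ t m ℚ.- t n ∣ ℚ.≤ a ℚ.* ∣ r m ℚ.- r n ∣ ℚ.+ b ℚ.* ∣ s m ℚ.- s n ∣) where

    isCauchy : IsCauchy t
    isCauchy ε 0<ε with divide 0<a (0<½* 0<ε) | divide 0<b (0<½* 0<ε)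
    ... | α , 0<α , aα≡ | β , 0<β , bβ≡ with cr α 0<α | cs β 0<β
    ... | N₁ , close₁ | N₂ , close₂ = N₀ ℕ.⊔ (N₁ ℕ.⊔ N₂) , close
      where
      open ℚ.≤-Reasoning
      N₁₂≤ : N₁ ℕ.⊔ N₂ ℕ.≤ N₀ ℕ.⊔ (N₁ ℕ.⊔ N₂)
      N₁₂≤ = ℕ.m≤n⊔m N₀ (N₁ ℕ.⊔ N₂)
      ≤₀ : ∀ {n} → N₀ ℕ.⊔ (N₁ ℕ.⊔ N₂) ℕ.≤ n → N₀ ℕ.≤ n
      ≤₀ = ℕ.≤-trans (ℕ.m≤m⊔n N₀ (N₁ ℕ.⊔ N₂))
      ≤₁ : ∀ {n} → N₀ ℕ.⊔ (N₁ ℕ.⊔ N₂) ℕ.≤ n → N₁ ℕ.≤ n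
      ≤₁ p = ℕ.≤-trans (ℕ.m≤m⊔n N₁ N₂) (ℕ.≤-trans N₁₂≤ p)
      ≤₂ : ∀ {n} → N₀ ℕ.⊔ (N₁ ℕ.⊔ N₂) ℕ.≤ n → N₂ ℕ.≤ n
      ≤₂ p = ℕ.≤-trans (ℕ.m≤n⊔m N₁ N₂) (ℕ.≤-trans N₁₂≤ p)
      close : ∀ m n → N₀ ℕ.⊔ (N₁ ℕ.⊔ N₂) ℕ.≤ m → N₀ ℕ.⊔ (N₁ ℕ.⊔ N₂) ℕ.≤ n → ∣ t m ℚ.- t n ∣ ℚ.< ε
      close m n p q = begin-strict
        ∣ t m ℚ.- t n ∣
          ≤⟨ dom m n (≤₀ p) (≤₀ q) ⟩
        a ℚ.* ∣ r m ℚ.- r n ∣ ℚ.+ b ℚ.* ∣ s m ℚ.- s n ∣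
          <⟨ ℚ.+-mono-< (ℚ.*-monoʳ-<-pos a {{ℚ.positive 0<a}} (close₁ m n (≤₁ p) (≤₁ q)))
                        (ℚ.*-monoʳ-<-pos b {{ℚ.positive 0<b}} (close₂ m n (≤₂ p) (≤₂ q))) ⟩
        a ℚ.* α ℚ.+ b ℚ.* β
          ≡⟨ cong₂ ℚ._+_ aα≡ bβ≡ ⟩
        ½ ℚ.* ε ℚ.+ ½ ℚ.* ε
          ≡⟨ ½*+½* ε ⟩
        ε ∎

  *-isCauchy : ∀ r s → IsCauchy r → IsCauchy s → IsCauchy (λ n → r n ℚ.* s n)
  *-isCauchy r s cr cs = combine (bounded r cr) (bounded s cs)
    where
    open ℚ.≤-Reasoning
    split : ∀ a b c d → a ℚ.* b ℚ.- c ℚ.* d ≡ a ℚ.* (b ℚ.- d) ℚ.+ d ℚ.* (a ℚ.- c)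
    split = solve 4 (λ a b c d → a :* b :- c :* d := a :* (b :- d) :+ d :* (a :- c)) refl
    combine : EventuallyBounded r → EventuallyBounded s → IsCauchy (λ n → r n ℚ.* s n)
    combine (a , 0<a , N₁ , r≤a) (b , 0<b , N₂ , s≤b) =
      Dominated.isCauchy s r (λ n → r n ℚ.* s n) cs cr 0<a 0<b (N₁ ℕ.⊔ N₂) λ m n p q → begin
      ∣ r m ℚ.* s m ℚ.- r n ℚ.* s n ∣
        ≡⟨ cong ∣_∣ (split (r m) (s m) (r n) (s n)) ⟩
      ∣ r m ℚ.* (s m ℚ.- s n) ℚ.+ s n ℚ.* (r m ℚ.- r n) ∣
        ≤⟨ ℚ.∣p+q∣≤∣p∣+∣q∣ (r m ℚ.* (s m ℚ.- s n)) (s n ℚ.* (r m ℚ.- r n)) ⟩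
      ∣ r m ℚ.* (s m ℚ.- s n) ∣ ℚ.+ ∣ s n ℚ.* (r m ℚ.- r n) ∣
        ≤⟨ ℚ.+-mono-≤
             (*-mono-≤-abs (r m) (s m ℚ.- s n) (ℚ.<⇒≤ 0<a) (r≤a m (ℕ.m⊔n≤o⇒m≤o N₁ N₂ p)) ℚ.≤-refl)
             (*-mono-≤-abs (s n) (r m ℚ.- r n) (ℚ.<⇒≤ 0<b) (s≤b n (ℕ.m⊔n≤o⇒n≤o N₁ N₂ q)) ℚ.≤-refl) ⟩
      a ℚ.* ∣ s m ℚ.- s n ∣ ℚ.+ b ℚ.* ∣ r m ℚ.- r n ∣ ∎

open CauchyLemmas

ℚ⇒ℝ : ℚ → ℝ
seq    (ℚ⇒ℝ q) _ = q
cauchy (ℚ⇒ℝ q) ε 0<ε = 0 , λ _ _ _ _ → subst (ℚ._< ε) (sym (cong ∣_∣ (ℚ.+-inverseʳ q))) 0<ε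

0ℝ 1ℝ : ℝ
0ℝ = ℚ⇒ℝ 0ℚ
1ℝ = ℚ⇒ℝ 1ℚ

infix  8 -ᴿ_
infixl 7 _*ᴿ_
infixl 6 _+ᴿ_

_+ᴿ_ : ℝ → ℝ → ℝ
seq    (x +ᴿ y) n = seq x n ℚ.+ seq y n
cauchy (x +ᴿ y) = Dominated.isCauchy (seq x) (seq y) (λ n → seq x n ℚ.+ seq y n) (cauchy x) (cauchy y) 0<1 0<1 0 λ m n _ _ →
  let xm = seq x m ; xn = seq x n ; ym = seq y m ; yn = seq y n in begin
  ∣ (xm ℚ.+ ym) ℚ.- (xn ℚ.+ yn) ∣
    ≡⟨ cong ∣_∣ (solve 4 (λ a b c d → (a :+ b) :- (c :+ d) := (a :- c) :+ (b :- d)) refl xm ym xn yn) ⟩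
  ∣ (xm ℚ.- xn) ℚ.+ (ym ℚ.- yn) ∣
    ≤⟨ ℚ.∣p+q∣≤∣p∣+∣q∣ (xm ℚ.- xn) (ym ℚ.- yn) ⟩
  ∣ xm ℚ.- xn ∣ ℚ.+ ∣ ym ℚ.- yn ∣
    ≡⟨ cong₂ ℚ._+_ (sym (ℚ.*-identityˡ ∣ xm ℚ.- xn ∣)) (sym (ℚ.*-identityˡ ∣ ym ℚ.- yn ∣)) ⟩
  1ℚ ℚ.* ∣ xm ℚ.- xn ∣ ℚ.+ 1ℚ ℚ.* ∣ ym ℚ.- yn ∣ ∎
  where open ℚ.≤-Reasoning

-ᴿ_ : ℝ → ℝ
seq    (-ᴿ x) n = ℚ.- seq x n
cauchy (-ᴿ x) ε 0<ε with cauchy x ε 0<ε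
... | N , close = N , λ m n p q → subst (ℚ._< ε)
  (trans (sym (ℚ.∣-p∣≡∣p∣ (seq x m ℚ.- seq x n)))
         (cong ∣_∣ (solve 2 (λ a b → :- (a :- b) := (:- a) :- (:- b)) refl (seq x m) (seq x n))))
  (close m n p q)

_*ᴿ_ : ℝ → ℝ → ℝ
seq    (x *ᴿ y) n = seq x n ℚ.* seq y n
cauchy (x *ᴿ y) = *-isCauchy (seq x) (seq y) (cauchy x) (cauchy y)

-- The value at 0 is junk: a sequence apart from 0 is eventually nonzero.
recipℚ : ℚ → ℚ
recipℚ q with q ℚ.≟ 0ℚ
... | yes _   = 0ℚ
... | no  q≢0 = ℚ.1/_ q {{ℚ.≢-nonZero q≢0}}

module RecipLemmas where

  recipℚ-inverse : ∀ {ε} q → 0ℚ ℚ.< ε → ε ℚ.≤ ∣ q ∣ → q ℚ.* recipℚ q ≡ 1ℚ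
  recipℚ-inverse q 0<ε ε≤ with q ℚ.≟ 0ℚ
  ... | yes refl = contradiction (ℚ.<-≤-trans 0<ε ε≤) (ℚ.<-irrefl refl)
  ... | no  q≢0  = ℚ.*-inverseʳ q {{ℚ.≢-nonZero q≢0}}

  recipℚ-bound : ∀ {ε δ} q → 0ℚ ℚ.< ε → 0ℚ ℚ.< δ → ε ℚ.* δ ≡ 1ℚ → ε ℚ.≤ ∣ q ∣ → ∣ recipℚ q ∣ ℚ.≤ δ
  recipℚ-bound {ε} {δ} q 0<ε 0<δ εδ≡1 ε≤ = begin
    ∣ r ∣                       ≡⟨ sym (ℚ.*-identityʳ _) ⟩
    ∣ r ∣ ℚ.* 1ℚ                ≡⟨ cong (∣ r ∣ ℚ.*_) (sym εδ≡1) ⟩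
    ∣ r ∣ ℚ.* (ε ℚ.* δ)         ≤⟨ ℚ.*-monoˡ-≤-nonNeg ∣ r ∣ {{ℚ.nonNegative (ℚ.0≤∣p∣ r)}}
                                     (ℚ.*-monoʳ-≤-nonNeg δ {{ℚ.nonNegative (ℚ.<⇒≤ 0<δ)}} ε≤) ⟩
    ∣ r ∣ ℚ.* (∣ q ∣ ℚ.* δ)     ≡⟨ solve 3 (λ a b c → a :* (b :* c) := (b :* a) :* c) refl (∣ r ∣) (∣ q ∣) δ ⟩
    (∣ q ∣ ℚ.* ∣ r ∣) ℚ.* δ     ≡⟨ cong (ℚ._* δ) (sym (ℚ.∣p*q∣≡∣p∣*∣q∣ q r)) ⟩
    ∣ q ℚ.* r ∣ ℚ.* δ           ≡⟨ cong (λ z → ∣ z ∣ ℚ.* δ) (recipℚ-inverse q 0<ε ε≤) ⟩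
    1ℚ ℚ.* δ                    ≡⟨ ℚ.*-identityˡ δ ⟩
    δ                           ∎
    where
    open ℚ.≤-Reasoning
    r = recipℚ q

  recipℚ-sub : ∀ {ε δ} p q → 0ℚ ℚ.< ε → 0ℚ ℚ.< δ → ε ℚ.* δ ≡ 1ℚ → ε ℚ.≤ ∣ p ∣ → ε ℚ.≤ ∣ q ∣ →
    ∣ recipℚ p ℚ.- recipℚ q ∣ ℚ.≤ (δ ℚ.* δ) ℚ.* ∣ p ℚ.- q ∣
  recipℚ-sub {ε} {δ} p q 0<ε 0<δ εδ≡1 ε≤p ε≤q = begin
    ∣ p′ ℚ.- q′ ∣
      ≡⟨ cong ∣_∣ (cong₂ ℚ._-_ (sym (ℚ.*-identityˡ p′)) (sym (ℚ.*-identityˡ q′))) ⟩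
    ∣ 1ℚ ℚ.* p′ ℚ.- 1ℚ ℚ.* q′ ∣
      ≡⟨ cong ∣_∣ (cong₂ (λ v w → v ℚ.* p′ ℚ.- w ℚ.* q′)
           (sym (recipℚ-inverse q 0<ε ε≤q)) (sym (recipℚ-inverse p 0<ε ε≤p))) ⟩
    ∣ (q ℚ.* q′) ℚ.* p′ ℚ.- (p ℚ.* p′) ℚ.* q′ ∣
      ≡⟨ cong ∣_∣ (solve 4 (λ a b a′ b′ → (b :* b′) :* a′ :- (a :* a′) :* b′ := (a′ :* b′) :* (:- (a :- b))) refl p q p′ q′) ⟩
    ∣ (p′ ℚ.* q′) ℚ.* (ℚ.- (p ℚ.- q)) ∣
      ≤⟨ *-mono-≤-abs (p′ ℚ.* q′) (ℚ.- (p ℚ.- q)) 0≤δδ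
           (*-mono-≤-abs p′ q′ (ℚ.<⇒≤ 0<δ) (recipℚ-bound p 0<ε 0<δ εδ≡1 ε≤p) (recipℚ-bound q 0<ε 0<δ εδ≡1 ε≤q))
           (ℚ.≤-reflexive (ℚ.∣-p∣≡∣p∣ (p ℚ.- q))) ⟩
    (δ ℚ.* δ) ℚ.* ∣ p ℚ.- q ∣ ∎
    where
    open ℚ.≤-Reasoning
    p′ = recipℚ p
    q′ = recipℚ q
    0≤δδ = ℚ.<⇒≤ (0<* 0<δ 0<δ)

open RecipLemmas

infix 9 _⁻¹ᴿ[_]

_⁻¹ᴿ[_] : (x : ℝ) → x #ᴿ 0ℝ → ℝ
seq    (x ⁻¹ᴿ[ _ ]) n = recipℚ (seq x n)
cauchy (x ⁻¹ᴿ[ mk# ε 0<ε N gap≤ ]) with divide 0<ε 0<1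
... | δ , 0<δ , εδ≡1 =
  Dominated.isCauchy (seq x) (seq x) (λ n → recipℚ (seq x n)) (cauchy x) (cauchy x) (0<* 0<δ 0<δ) 0<1 N λ m n p q →
  let d = ∣ seq x m ℚ.- seq x n ∣ in begin
  ∣ recipℚ (seq x m) ℚ.- recipℚ (seq x n) ∣
    ≤⟨ recipℚ-sub (seq x m) (seq x n) 0<ε 0<δ εδ≡1 (ε≤ m p) (ε≤ n q) ⟩
  (δ ℚ.* δ) ℚ.* d
    ≡⟨ sym (ℚ.+-identityʳ _) ⟩
  (δ ℚ.* δ) ℚ.* d ℚ.+ 0ℚ
    ≤⟨ ℚ.+-monoʳ-≤ ((δ ℚ.* δ) ℚ.* d) (ℚ.0≤∣p∣ (seq x m ℚ.- seq x n)) ⟩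
  (δ ℚ.* δ) ℚ.* d ℚ.+ d
    ≡⟨ cong ((δ ℚ.* δ) ℚ.* d ℚ.+_) (sym (ℚ.*-identityˡ d)) ⟩
  (δ ℚ.* δ) ℚ.* d ℚ.+ 1ℚ ℚ.* d ∎
  where
  open ℚ.≤-Reasoning
  ε≤ : ∀ n → N ℕ.≤ n → ε ℚ.≤ ∣ seq x n ∣
  ε≤ n p = subst (λ z → ε ℚ.≤ ∣ z ∣) (ℚ.+-identityʳ (seq x n)) (gap≤ n p)

infix 5 _+i_

record ℂ : Set where
  no-eta-equality
  constructor _+i_
  field
    re im : ℝ

open ℂ public

infix 4 _≈_ _#_

record _≈_ (z w : ℂ) : Set where
  constructor mk≈ℂ
  field
    re≈ : re z ≈ᴿ re w
    im≈ : im z ≈ᴿ im w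

_#_ : ℂ → ℂ → Set
z # w = (re z #ᴿ re w) ⊎ (im z #ᴿ im w)

ℝ⇒ℂ : ℝ → ℂ
ℝ⇒ℂ x = x +i 0ℝ

ℚ⇒ℂ : ℚ → ℂ
ℚ⇒ℂ q = ℝ⇒ℂ (ℚ⇒ℝ q)

ℕ⇒ℂ : ℕ → ℂ
ℕ⇒ℂ n = ℚ⇒ℂ (+ n ℚ./ 1)

0ℂ 1ℂ i : ℂ
0ℂ = ℝ⇒ℂ 0ℝ
1ℂ = ℝ⇒ℂ 1ℝ
i  = 0ℝ +i 1ℝ

infix  8 -_
infixl 7 _*_
infixl 6 _+_ _-_

_+_ : ℂ → ℂ → ℂ
re (z + w) = re z +ᴿ re w
im (z + w) = im z +ᴿ im w

-_ : ℂ → ℂ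
re (- z) = -ᴿ re z
im (- z) = -ᴿ im z

_-_ : ℂ → ℂ → ℂ
z - w = z + (- w)

_*_ : ℂ → ℂ → ℂ
re (z * w) = re z *ᴿ re w +ᴿ -ᴿ (im z *ᴿ im w)
im (z * w) = re z *ᴿ im w +ᴿ im z *ᴿ re w

∣_∣² : ℂ → ℝ
∣ z ∣² = re z *ᴿ re z +ᴿ im z *ᴿ im z

#0⇒∣∣²#0 : ∀ z → z # 0ℂ → ∣ z ∣² #ᴿ 0ℝ
#0⇒∣∣²#0 z = λ where
    (inj₁ (mk# ε 0<ε N gap≤)) → mk# (ε ℚ.* ε) (0<* 0<ε 0<ε) N λ n p →
      subst (ε ℚ.* ε ℚ.≤_) (sym (simplify (a n) (b n)))
        (ℚ.≤-trans (square≤ (a n) 0<ε (gap≤ n p))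
          (subst (ℚ._≤ a n ℚ.* a n ℚ.+ b n ℚ.* b n) (ℚ.+-identityʳ _)
            (ℚ.+-monoʳ-≤ (a n ℚ.* a n) (0≤square (b n)))))
    (inj₂ (mk# ε 0<ε N gap≤)) → mk# (ε ℚ.* ε) (0<* 0<ε 0<ε) N λ n p →
      subst (ε ℚ.* ε ℚ.≤_) (sym (simplify (a n) (b n)))
        (ℚ.≤-trans (square≤ (b n) 0<ε (gap≤ n p))
          (subst (ℚ._≤ a n ℚ.* a n ℚ.+ b n ℚ.* b n) (ℚ.+-identityˡ _)
            (ℚ.+-monoˡ-≤ (b n ℚ.* b n) (0≤square (a n)))))
  where
  a b : ℕ → ℚ
  a = seq (re z)
  b = seq (im z)

  ∣q∣²≡q² : ∀ q → ∣ q ∣ ℚ.* ∣ q ∣ ≡ q ℚ.* q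
  ∣q∣²≡q² q with ℚ.∣p∣≡p∨∣p∣≡-p q
  ... | inj₁ eq = cong₂ ℚ._*_ eq eq
  ... | inj₂ eq = trans (cong₂ ℚ._*_ eq eq) (solve 1 (λ x → (:- x) :* (:- x) := x :* x) refl q)

  0≤square : ∀ q → 0ℚ ℚ.≤ q ℚ.* q
  0≤square q = subst (0ℚ ℚ.≤_) (trans (ℚ.∣p*q∣≡∣p∣*∣q∣ q q) (∣q∣²≡q² q)) (ℚ.0≤∣p∣ (q ℚ.* q))

  square≤ : ∀ {ε} q → 0ℚ ℚ.< ε → ε ℚ.≤ ∣ q ℚ.- 0ℚ ∣ → ε ℚ.* ε ℚ.≤ q ℚ.* q
  square≤ {ε} q 0<ε ε≤ = begin
    ε ℚ.* ε           ≤⟨ ℚ.*-monoˡ-≤-nonNeg ε {{ℚ.nonNegative (ℚ.<⇒≤ 0<ε)}} ε≤q ⟩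
    ε ℚ.* ∣ q ∣       ≤⟨ ℚ.*-monoʳ-≤-nonNeg ∣ q ∣ {{ℚ.nonNegative (ℚ.0≤∣p∣ q)}} ε≤q ⟩
    ∣ q ∣ ℚ.* ∣ q ∣   ≡⟨ ∣q∣²≡q² q ⟩
    q ℚ.* q           ∎
    where
    open ℚ.≤-Reasoning
    ε≤q = subst (λ p → ε ℚ.≤ ∣ p ∣) (ℚ.+-identityʳ q) ε≤

  simplify : ∀ p q → ∣ (p ℚ.* p ℚ.+ q ℚ.* q) ℚ.- 0ℚ ∣ ≡ p ℚ.* p ℚ.+ q ℚ.* q
  simplify p q = trans (cong ∣_∣ (ℚ.+-identityʳ (p ℚ.* p ℚ.+ q ℚ.* q)))
    (ℚ.0≤p⇒∣p∣≡p (ℚ.+-mono-≤ (0≤square p) (0≤square q)))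

infix 9 _⁻¹[_]

_⁻¹[_] : (z : ℂ) → z # 0ℂ → ℂ
re (z ⁻¹[ z#0 ]) = re z *ᴿ ∣ z ∣² ⁻¹ᴿ[ #0⇒∣∣²#0 z z#0 ]
im (z ⁻¹[ z#0 ]) = -ᴿ im z *ᴿ ∣ z ∣² ⁻¹ᴿ[ #0⇒∣∣²#0 z z#0 ]

ℂ-rawRing : RawRing 0ℓ 0ℓ
ℂ-rawRing = record
  { Carrier = ℂ ; _≈_ = _≈_ ; _+_ = _+_ ; _*_ = _*_ ; -_ = -_ ; 0# = 0ℂ ; 1# = 1ℂ }

open RawSemiringDefs (RawRing.rawSemiring ℂ-rawRing) using (sum)

∑≤ : ℕ → (ℕ → ℂ) → ℂ
∑≤ n f = sum {suc n} (λ j → f (toℕ j))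

infixr 6 ∑≤
syntax ∑≤ n (λ j → e) = ∑[ j ≤ n ] e

-- Formal power series in t, given by their coefficients.

Series : Set
Series = ℕ → ℂ

_≈ˢ_ : Series → Series → Set
a ≈ˢ b = ∀ n → a n ≈ b n

constˢ : ℂ → Series
constˢ z zero    = z
constˢ z (suc _) = 0ℂ

infix  8 -ˢ_
infixl 7 _*ˢ_ _·ˢ_
infixl 6 _+ˢ_ _-ˢ_

_+ˢ_ : Series → Series → Series
(a +ˢ b) n = a n + b n

-ˢ_ : Series → Series
(-ˢ a) n = - a n

_-ˢ_ : Series → Series → Series
a -ˢ b = a +ˢ (-ˢ b)

_·ˢ_ : ℂ → Series → Series
(z ·ˢ a) n = z * a n

_*ˢ_ : Series → Series → Series
(a *ˢ b) n = ∑[ j ≤ n ] a j * b (n ∸ j)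

Series-rawRing : RawRing 0ℓ 0ℓ
Series-rawRing = record
  { Carrier = Series ; _≈_ = _≈ˢ_ ; _+_ = _+ˢ_ ; _*_ = _*ˢ_ ; -_ = -ˢ_
  ; 0# = constˢ 0ℂ ; 1# = constˢ 1ℂ }

open RawSemiringDefs (RawRing.rawSemiring Series-rawRing) using () renaming (_^_ to _^ˢ_) public

-- a(b(t)), for b with zero constant term; then b ^ˢ j has no terms of degree
-- below j, so only j ≤ n contribute to the coefficient of t^n.
_∘ˢ_ : Series → Series → Series
(a ∘ˢ b) n = ∑[ j ≤ n ] a j * (b ^ˢ j) n

-- The coefficients b_n , … , b_0 of 1/a(t), given c = 1/a_0, from
-- b_0 = c and b_(n+1) = - c ∑_(j ≤ n) a_(j+1) b_(n-j).
reciprocalCoeffs : Series → ℂ → (n : ℕ) → Vec ℂ (suc n)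
reciprocalCoeffs a c zero    = c ∷ []
reciprocalCoeffs a c (suc n) =
  - c * sum {suc n} (λ j → a (suc (toℕ j)) * lookup bs j) ∷ bs
  where bs = reciprocalCoeffs a c n

infixl 7 _/ˢ_[_]

_/ˢ_[_] : Series → (a : Series) → a 0 # 0ℂ → Series
b /ˢ a [ a₀#0 ] = b *ˢ (λ n → head (reciprocalCoeffs a (a 0 ⁻¹[ a₀#0 ]) n))

1/_! : ℕ → ℂ
1/ n ! = ℚ⇒ℂ (ℚ._/_ (+ 1) (n !) {{n ℕ.!≢0}})

-- The n-th coefficient of a with respect to the basis t^n / n!.
egfCoeff : Series → ℕ → ℂ
egfCoeff a n = ℕ⇒ℂ (n !) * a n

-- (z)_{n,λ} = z (z - λ) ⋯ (z - (n-1) λ)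
fallingλ : ℝ → ℂ → ℕ → ℂ
fallingλ lam z zero    = 1ℂ
fallingλ lam z (suc n) = fallingλ lam z n * (z - ℕ⇒ℂ n * ℝ⇒ℂ lam)

falling : ℂ → ℕ → ℂ
falling z zero    = 1ℂ
falling z (suc n) = falling z n * (z - ℕ⇒ℂ n)

-- e_λ^z(t)
expλ : ℝ → ℂ → Series
expλ lam z n = fallingλ lam z n * 1/ n !

-- (1 + t)^z, the binomial series
[1+t]^_ : ℂ → Series
([1+t]^ z) n = falling z n * 1/ n !

logλ[1+t] : (lam : ℝ) → lam #ᴿ 0ℝ → Series
logλ[1+t] lam lam#0 = ℝ⇒ℂ (lam ⁻¹ᴿ[ lam#0 ]) ·ˢ ([1+t]^ (ℝ⇒ℂ lam) -ˢ constˢ 1ℂ)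

-- n^(-k)
_^-_ : (n : ℕ) .{{_ : ℕ.NonZero n}} → ℤ → ℚ
n ^- (+ j)    = ℚ._/_ (+ 1) (n ℕ.^ j) {{ℕ.m^n≢0 n j}}
n ^- -[1+ j ] = + (n ℕ.^ suc j) ℚ./ 1

Ei : ℤ → ℝ → Series
Ei k lam zero    = 0ℂ
Ei k lam (suc m) = fallingλ lam 1ℂ (suc m) * ℚ⇒ℂ (suc m ^- k) * 1/ m !

-- S_{2,λ}^{(x)}(n , r)
S₂ : ℝ → ℝ → ℕ → ℕ → ℂ
S₂ lam x n r =
  egfCoeff (1/ r ! ·ˢ (expλ lam 1ℂ -ˢ constˢ 1ℂ) ^ˢ r *ˢ expλ lam (ℝ⇒ℂ x)) n

2i : ℂ
2i = ℕ⇒ℂ 2 * i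

2i#0 : 2i # 0ℂ
2i#0 = inj₂ (mk# 1ℚ 0<1 0 λ _ _ → toWitness {a? = 1ℚ ℚ.≤? ∣ seq (im 2i) 0 ℚ.- 0ℚ ∣} _)

cosλ sinλ : ℝ → ℝ → Series
cosλ lam y = ℚ⇒ℂ ½ ·ˢ (expλ lam (i * ℝ⇒ℂ y) +ˢ expλ lam (- (i * ℝ⇒ℂ y)))
sinλ lam y = 2i ⁻¹[ 2i#0 ] ·ˢ (expλ lam (i * ℝ⇒ℂ y) -ˢ expλ lam (- (i * ℝ⇒ℂ y)))

expλ-u#0 : ∀ lam u → u # 1ℂ → (expλ lam 1ℂ -ˢ constˢ u) 0 # 0ℂ
expλ-u#0 lam u = λ where
    (inj₁ (mk# ε 0<ε N gap≤)) → inj₁ (mk# ε 0<ε N λ n p → subst (ε ℚ.≤_) (flip 1ℚ (seq (re u) n)) (gap≤ n p))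
    (inj₂ (mk# ε 0<ε N gap≤)) → inj₂ (mk# ε 0<ε N λ n p → subst (ε ℚ.≤_) (flip 0ℚ (seq (im u) n)) (gap≤ n p))
  where
  flip : ∀ c q → ∣ q ℚ.- c ∣ ≡ ∣ (c ℚ.- q) ℚ.- 0ℚ ∣
  flip c q = trans (sym (ℚ.∣-p∣≡∣p∣ (q ℚ.- c)))
    (cong ∣_∣ (solve 2 (λ a b → :- (b :- a) := (a :- b) :- con 0ℚ) refl c q))

-- FGᶜ … n x y and FGˢ … n x y are FG_{n,λ}^{[k,c]}(x,y;u) and FG_{n,λ}^{[k,s]}(x,y;u).
module _ (k : ℤ) (lam : ℝ) (lam#0 : lam #ᴿ 0ℝ) (u : ℂ) (u#1 : u # 1ℂ) where

  FG-kernel : Series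
  FG-kernel = (1ℂ - u) ·ˢ (Ei k lam ∘ˢ logλ[1+t] lam lam#0)
              /ˢ (expλ lam 1ℂ -ˢ constˢ u) [ expλ-u#0 lam u u#1 ]

  FGᶜ FGˢ : ℕ → (x y : ℝ) → ℂ
  FGᶜ n x y = egfCoeff (FG-kernel *ˢ expλ lam (ℝ⇒ℂ x) *ˢ cosλ lam y) n
  FGˢ n x y = egfCoeff (FG-kernel *ˢ expλ lam (ℝ⇒ℂ x) *ˢ sinλ lam y) n

{-# OPTIONS --safe #-}

-- The derivation θ = (1 + λt) d/dt satisfies θ e_λ^z = z e_λ^z and θ (e_λ - 1) = (e_λ - 1) + 1.
-- Applied to (e_λ - 1)^r e_λ^x / r! it yields
--   S(m+1 , r) = (r + x - mλ) S(m , r) + S(m , r-1),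
-- and since (z)_(r+1) = (z - r) (z)_r, the sums A_m = ∑_r S(m , r) (z)_r satisfy
-- A_(m+1) = (x + z - mλ) A_m, so A_m = (x + z)_{m,λ} = m! [t^m] e_λ^(x+z).
-- The theorem is then the coefficient form of the product of e_λ^(x₁+x₂) with the
-- generating function of FG(0 , y), whatever the remaining factors of the latter are.
module Submission where

open import Defs
open import Algebra.Bundles using (CommutativeRing)
import Algebra.Consequences.Setoid as Consequences
import Algebra.Construct.Pointwise as Pointwise
import Algebra.Properties.CommutativeMonoid.Sum as MonoidSum
import Algebra.Properties.Semiring.Sum as SemiringSum
import Algebra.Solver.Ring.NaturalCoefficients.Default as NaturalSolver
open import Data.Fin.Base using (toℕ)
open import Data.Fin.Properties using (toℕ≤pred[n])
open import Data.Integer.Base as ℤ using (ℤ; +_)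
import Data.Integer.Properties as ℤ
open import Data.Nat.Base as ℕ using (ℕ; zero; suc; _∸_; _!; s≤s)
open import Data.Nat.Combinatorics using (_C_; nCk≡n!/k![n-k]!; [n∸k]!k!∣n!)
import Data.Nat.Divisibility as ℕ
import Data.Nat.DivMod as ℕ
import Data.Nat.Properties as ℕ
open import Data.Product.Base using (_×_; _,_)
open import Data.Rational.Base as ℚ using (0ℚ; 1ℚ; ½; ∣_∣)
import Data.Rational.Properties as ℚ
open import Data.Rational.Solver using (module +-*-Solver)
open import Data.Rational.Unnormalised.Base as ℚᵘ using (mkℚᵘ; *≡*)
import Data.Rational.Unnormalised.Properties as ℚᵘ
open import Level using (0ℓ)
open import Relation.Binary.Bundles using (Setoid)
open import Relation.Binary.PropositionalEquality as ≡ using (_≡_)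
import Relation.Binary.Reasoning.Setoid as SetoidReasoning

open CauchyLemmas
open _≈ᴿ_
open _≈_

-- Equality of real and complex numbers

-- The usual route expands e_λ^z = (1 + (e_λ - 1))^z by the binomial series and multiplies by e_λ^x.
-- For real z this takes a composition of series and a law of exponents. Comparing two sequences
-- that start at 1 and obey the same first-order recursion replaces both. The choice of θ: d/dt
-- turns e_λ^z into z e_λ^(z-λ), and the factor 1 + λt = e_λ^λ restores the exponent. Its part λt
-- d/dt is the source of -mλ. A_m stops at r = m while A_(m+1) runs to m + 1; the vanishing of S(m ,
-- r) for m < r reconciles the ranges. Equality on ℝ means that a difference tends to 0, so the ring
-- axioms of ℂ and of series are established beforehand; the ring solvers rest on them.

pointwise : ∀ {x y} → (∀ n → seq x n ≡ seq y n) → x ≈ᴿ y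
pointwise {x} {y} eq = mk≈ λ ε 0<ε → 0 , λ n _ →
  ≡.subst (ℚ._< ε) (≡.cong ∣_∣ (≡.sym (≡.trans (≡.cong (ℚ._- seq y n) (eq n)) (ℚ.+-inverseʳ (seq y n))))) 0<ε

-- Half of ε goes to each term: the two differences are brought below ε / (2a) and ε / (2b).
-- Transitivity and the congruence of `_+ᴿ_` and `_*ᴿ_` are instances; the threshold `N₀` serves
-- products, whose factors are bounded only eventually.
≈ᴿ-dominated : ∀ {x x′ y y′ z z′ a b} → 0ℚ ℚ.< a → 0ℚ ℚ.< b → ∀ N₀ →
  (∀ n → N₀ ℕ.≤ n → ∣ seq z n ℚ.- seq z′ n ∣
    ℚ.≤ a ℚ.* ∣ seq x n ℚ.- seq x′ n ∣ ℚ.+ b ℚ.* ∣ seq y n ℚ.- seq y′ n ∣) →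
  x ≈ᴿ x′ → y ≈ᴿ y′ → z ≈ᴿ z′
≈ᴿ-dominated {x} {x′} {y} {y′} {z} {z′} {a} {b} 0<a 0<b N₀ dom x≈ y≈ = mk≈ close
  where
  open ℚ.≤-Reasoning
  close : ∀ ε → 0ℚ ℚ.< ε → _
  close ε 0<ε with divide 0<a (0<½* 0<ε) | divide 0<b (0<½* 0<ε)
  ... | α , 0<α , aα≡ | β , 0<β , bβ≡ with tendsto x≈ α 0<α | tendsto y≈ β 0<β
  ... | N₁ , close₁ | N₂ , close₂ = N₀ ℕ.⊔ (N₁ ℕ.⊔ N₂) , λ n p →
    let N₁₂≤n = ℕ.m⊔n≤o⇒n≤o N₀ (N₁ ℕ.⊔ N₂) p in begin-strict
    ∣ seq z n ℚ.- seq z′ n ∣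
      ≤⟨ dom n (ℕ.m⊔n≤o⇒m≤o N₀ (N₁ ℕ.⊔ N₂) p) ⟩
    a ℚ.* ∣ seq x n ℚ.- seq x′ n ∣ ℚ.+ b ℚ.* ∣ seq y n ℚ.- seq y′ n ∣
      <⟨ ℚ.+-mono-< (ℚ.*-monoʳ-<-pos a {{ℚ.positive 0<a}} (close₁ n (ℕ.m⊔n≤o⇒m≤o N₁ N₂ N₁₂≤n)))
                    (ℚ.*-monoʳ-<-pos b {{ℚ.positive 0<b}} (close₂ n (ℕ.m⊔n≤o⇒n≤o N₁ N₂ N₁₂≤n))) ⟩
    a ℚ.* α ℚ.+ b ℚ.* β
      ≡⟨ ≡.cong₂ ℚ._+_ aα≡ bβ≡ ⟩
    ½ ℚ.* ε ℚ.+ ½ ℚ.* ε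
      ≡⟨ ½*+½* ε ⟩
    ε ∎

≈ᴿ-sum : ∀ {x x′ y y′ z z′} →
  (∀ n → seq z n ℚ.- seq z′ n ≡ (seq x n ℚ.- seq x′ n) ℚ.+ (seq y n ℚ.- seq y′ n)) →
  x ≈ᴿ x′ → y ≈ᴿ y′ → z ≈ᴿ z′
≈ᴿ-sum {x} {x′} {y} {y′} {z} {z′} eq = ≈ᴿ-dominated 0<1 0<1 0 λ n _ →
  let d = seq x n ℚ.- seq x′ n ; e = seq y n ℚ.- seq y′ n in begin
  ∣ seq z n ℚ.- seq z′ n ∣              ≡⟨ ≡.cong ∣_∣ (eq n) ⟩
  ∣ d ℚ.+ e ∣                           ≤⟨ ℚ.∣p+q∣≤∣p∣+∣q∣ d e ⟩
  ∣ d ∣ ℚ.+ ∣ e ∣                       ≡⟨ ≡.cong₂ ℚ._+_ (ℚ.*-identityˡ ∣ d ∣) (ℚ.*-identityˡ ∣ e ∣) ⟨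
  1ℚ ℚ.* ∣ d ∣ ℚ.+ 1ℚ ℚ.* ∣ e ∣         ∎
  where open ℚ.≤-Reasoning

≈ᴿ-refl : ∀ {x} → x ≈ᴿ x
≈ᴿ-refl = pointwise λ _ → ≡.refl

≈ᴿ-trans : ∀ {x y z} → x ≈ᴿ y → y ≈ᴿ z → x ≈ᴿ z
≈ᴿ-trans {x} {y} {z} = ≈ᴿ-sum λ n →
  solve 3 (λ a b c → a :- c := (a :- b) :+ (b :- c)) ≡.refl (seq x n) (seq y n) (seq z n)
  where open +-*-Solver

+ᴿ-cong : ∀ {x x′ y y′} → x ≈ᴿ x′ → y ≈ᴿ y′ → x +ᴿ y ≈ᴿ x′ +ᴿ y′
+ᴿ-cong {x} {x′} {y} {y′} = ≈ᴿ-sum λ n →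
  solve 4 (λ a b c d → (a :+ c) :- (b :+ d) := (a :- b) :+ (c :- d)) ≡.refl (seq x n) (seq x′ n) (seq y n) (seq y′ n)
  where open +-*-Solver

≈ᴿ-neg : ∀ {x x′ z z′} → (∀ n → seq z n ℚ.- seq z′ n ≡ ℚ.- (seq x n ℚ.- seq x′ n)) → x ≈ᴿ x′ → z ≈ᴿ z′
≈ᴿ-neg {x} {x′} eq x≈ = mk≈ λ ε 0<ε → let N , close = tendsto x≈ ε 0<ε in
  N , λ n p → ≡.subst (ℚ._< ε) (≡.trans (≡.sym (ℚ.∣-p∣≡∣p∣ (seq x n ℚ.- seq x′ n))) (≡.cong ∣_∣ (≡.sym (eq n)))) (close n p)

≈ᴿ-sym : ∀ {x y} → x ≈ᴿ y → y ≈ᴿ x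
≈ᴿ-sym {x} {y} = ≈ᴿ-neg λ n → solve 2 (λ a b → b :- a := :- (a :- b)) ≡.refl (seq x n) (seq y n)
  where open +-*-Solver

-ᴿ-cong : ∀ {x y} → x ≈ᴿ y → -ᴿ x ≈ᴿ -ᴿ y
-ᴿ-cong {x} {y} = ≈ᴿ-neg λ n → solve 2 (λ a b → (:- a) :- (:- b) := :- (a :- b)) ≡.refl (seq x n) (seq y n)
  where open +-*-Solver

-- Bounds on `x` and `y′` suffice, since `split` writes the difference of the products as r (s - s′)
-- + s′ (r - r′). The term with s comes first, so the two equalities are passed on in reverse order.
*ᴿ-cong : ∀ {x x′ y y′} → x ≈ᴿ x′ → y ≈ᴿ y′ → x *ᴿ y ≈ᴿ x′ *ᴿ y′
*ᴿ-cong {x} {x′} {y} {y′} x≈ y≈ = combine (bounded (seq x) (cauchy x)) (bounded (seq y′) (cauchy y′))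
  where
  open ℚ.≤-Reasoning
  split : ∀ r r′ s s′ → r ℚ.* s ℚ.- r′ ℚ.* s′ ≡ r ℚ.* (s ℚ.- s′) ℚ.+ s′ ℚ.* (r ℚ.- r′)
  split = solve 4 (λ r r′ s s′ → r :* s :- r′ :* s′ := r :* (s :- s′) :+ s′ :* (r :- r′)) ≡.refl
    where open +-*-Solver
  combine : EventuallyBounded (seq x) → EventuallyBounded (seq y′) → x *ᴿ y ≈ᴿ x′ *ᴿ y′
  combine (a , 0<a , N₁ , x≤a) (b , 0<b , N₂ , y′≤b) = ≈ᴿ-dominated 0<a 0<b (N₁ ℕ.⊔ N₂) (λ n p →
    let r = seq x n ; r′ = seq x′ n ; s = seq y n ; s′ = seq y′ n in begin
    ∣ r ℚ.* s ℚ.- r′ ℚ.* s′ ∣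
      ≡⟨ ≡.cong ∣_∣ (split r r′ s s′) ⟩
    ∣ r ℚ.* (s ℚ.- s′) ℚ.+ s′ ℚ.* (r ℚ.- r′) ∣
      ≤⟨ ℚ.∣p+q∣≤∣p∣+∣q∣ (r ℚ.* (s ℚ.- s′)) (s′ ℚ.* (r ℚ.- r′)) ⟩
    ∣ r ℚ.* (s ℚ.- s′) ∣ ℚ.+ ∣ s′ ℚ.* (r ℚ.- r′) ∣
      ≤⟨ ℚ.+-mono-≤ (*-mono-≤-abs r (s ℚ.- s′) (ℚ.<⇒≤ 0<a) (x≤a n (ℕ.m⊔n≤o⇒m≤o N₁ N₂ p)) ℚ.≤-refl)
                    (*-mono-≤-abs s′ (r ℚ.- r′) (ℚ.<⇒≤ 0<b) (y′≤b n (ℕ.m⊔n≤o⇒n≤o N₁ N₂ p)) ℚ.≤-refl) ⟩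
    a ℚ.* ∣ s ℚ.- s′ ∣ ℚ.+ b ℚ.* ∣ r ℚ.- r′ ∣ ∎) y≈ x≈

-- Complex multiplication and the ring of complex numbers

module ComplexIdentities where
  open +-*-Solver

  -- Unprimed and primed letters are the real and imaginary parts at one index. Both sides have the
  -- form to which the operations of ℂ unfold there, as `pointwise` requires.
  *-assoc-re : ∀ a a′ b b′ c c′ →
    (a ℚ.* b ℚ.+ ℚ.- (a′ ℚ.* b′)) ℚ.* c ℚ.+ ℚ.- ((a ℚ.* b′ ℚ.+ a′ ℚ.* b) ℚ.* c′)
    ≡ a ℚ.* (b ℚ.* c ℚ.+ ℚ.- (b′ ℚ.* c′)) ℚ.+ ℚ.- (a′ ℚ.* (b ℚ.* c′ ℚ.+ b′ ℚ.* c))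
  *-assoc-re = solve 6 (λ a a′ b b′ c c′ →
    (a :* b :+ :- (a′ :* b′)) :* c :+ :- ((a :* b′ :+ a′ :* b) :* c′)
    := a :* (b :* c :+ :- (b′ :* c′)) :+ :- (a′ :* (b :* c′ :+ b′ :* c))) ≡.refl

  *-assoc-im : ∀ a a′ b b′ c c′ →
    (a ℚ.* b ℚ.+ ℚ.- (a′ ℚ.* b′)) ℚ.* c′ ℚ.+ (a ℚ.* b′ ℚ.+ a′ ℚ.* b) ℚ.* c
    ≡ a ℚ.* (b ℚ.* c′ ℚ.+ b′ ℚ.* c) ℚ.+ a′ ℚ.* (b ℚ.* c ℚ.+ ℚ.- (b′ ℚ.* c′))
  *-assoc-im = solve 6 (λ a a′ b b′ c c′ →
    (a :* b :+ :- (a′ :* b′)) :* c′ :+ (a :* b′ :+ a′ :* b) :* c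
    := a :* (b :* c′ :+ b′ :* c) :+ a′ :* (b :* c :+ :- (b′ :* c′))) ≡.refl

  *-comm-re : ∀ a a′ b b′ → a ℚ.* b ℚ.+ ℚ.- (a′ ℚ.* b′) ≡ b ℚ.* a ℚ.+ ℚ.- (b′ ℚ.* a′)
  *-comm-re = solve 4 (λ a a′ b b′ → a :* b :+ :- (a′ :* b′) := b :* a :+ :- (b′ :* a′)) ≡.refl

  *-comm-im : ∀ a a′ b b′ → a ℚ.* b′ ℚ.+ a′ ℚ.* b ≡ b ℚ.* a′ ℚ.+ b′ ℚ.* a
  *-comm-im = solve 4 (λ a a′ b b′ → a :* b′ :+ a′ :* b := b :* a′ :+ b′ :* a) ≡.refl

  *-identity-re : ∀ a a′ → 1ℚ ℚ.* a ℚ.+ ℚ.- (0ℚ ℚ.* a′) ≡ a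
  *-identity-re = solve 2 (λ a a′ → con 1ℚ :* a :+ :- (con 0ℚ :* a′) := a) ≡.refl

  *-identity-im : ∀ a a′ → 1ℚ ℚ.* a′ ℚ.+ 0ℚ ℚ.* a ≡ a′
  *-identity-im = solve 2 (λ a a′ → con 1ℚ :* a′ :+ con 0ℚ :* a := a′) ≡.refl

  distribˡ-re : ∀ a a′ b b′ c c′ → a ℚ.* (b ℚ.+ c) ℚ.+ ℚ.- (a′ ℚ.* (b′ ℚ.+ c′))
    ≡ (a ℚ.* b ℚ.+ ℚ.- (a′ ℚ.* b′)) ℚ.+ (a ℚ.* c ℚ.+ ℚ.- (a′ ℚ.* c′))
  distribˡ-re = solve 6 (λ a a′ b b′ c c′ → a :* (b :+ c) :+ :- (a′ :* (b′ :+ c′))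
    := (a :* b :+ :- (a′ :* b′)) :+ (a :* c :+ :- (a′ :* c′))) ≡.refl

  distribˡ-im : ∀ a a′ b b′ c c′ → a ℚ.* (b′ ℚ.+ c′) ℚ.+ a′ ℚ.* (b ℚ.+ c)
    ≡ (a ℚ.* b′ ℚ.+ a′ ℚ.* b) ℚ.+ (a ℚ.* c′ ℚ.+ a′ ℚ.* c)
  distribˡ-im = solve 6 (λ a a′ b b′ c c′ → a :* (b′ :+ c′) :+ a′ :* (b :+ c)
    := (a :* b′ :+ a′ :* b) :+ (a :* c′ :+ a′ :* c)) ≡.refl

≈-setoid : Setoid 0ℓ 0ℓ
≈-setoid = record
  { Carrier = ℂ ; _≈_ = _≈_
  ; isEquivalence = record
    { refl  = mk≈ℂ ≈ᴿ-refl ≈ᴿ-refl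
    ; sym   = λ p → mk≈ℂ (≈ᴿ-sym (re≈ p)) (≈ᴿ-sym (im≈ p))
    ; trans = λ p q → mk≈ℂ (≈ᴿ-trans (re≈ p) (re≈ q)) (≈ᴿ-trans (im≈ p) (im≈ q))
    }
  }

+-congᶜ : ∀ {z z′ w w′} → z ≈ z′ → w ≈ w′ → z + w ≈ z′ + w′
+-congᶜ p q = mk≈ℂ (+ᴿ-cong (re≈ p) (re≈ q)) (+ᴿ-cong (im≈ p) (im≈ q))

+-commᶜ : ∀ z w → z + w ≈ w + z
+-commᶜ z w = mk≈ℂ
  (pointwise λ n → ℚ.+-comm (seq (re z) n) (seq (re w) n))
  (pointwise λ n → ℚ.+-comm (seq (im z) n) (seq (im w) n))

*-commᶜ : ∀ z w → z * w ≈ w * z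
*-commᶜ z w = mk≈ℂ
  (pointwise λ n → *-comm-re (seq (re z) n) (seq (im z) n) (seq (re w) n) (seq (im w) n))
  (pointwise λ n → *-comm-im (seq (re z) n) (seq (im z) n) (seq (re w) n) (seq (im w) n))
  where open ComplexIdentities

*-assocᶜ : ∀ z w v → z * w * v ≈ z * (w * v)
*-assocᶜ z w v = mk≈ℂ
  (pointwise λ n → *-assoc-re
    (seq (re z) n) (seq (im z) n) (seq (re w) n) (seq (im w) n) (seq (re v) n) (seq (im v) n))
  (pointwise λ n → *-assoc-im
    (seq (re z) n) (seq (im z) n) (seq (re w) n) (seq (im w) n) (seq (re v) n) (seq (im v) n))
  where open ComplexIdentities

*-distribˡ-+ᶜ : ∀ z w v → z * (w + v) ≈ z * w + z * v
*-distribˡ-+ᶜ z w v = mk≈ℂ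
  (pointwise λ n → distribˡ-re
    (seq (re z) n) (seq (im z) n) (seq (re w) n) (seq (im w) n) (seq (re v) n) (seq (im v) n))
  (pointwise λ n → distribˡ-im
    (seq (re z) n) (seq (im z) n) (seq (re w) n) (seq (im w) n) (seq (re v) n) (seq (im v) n))
  where open ComplexIdentities

*-identityˡᶜ : ∀ z → 1ℂ * z ≈ z
*-identityˡᶜ z = mk≈ℂ
  (pointwise λ n → *-identity-re (seq (re z) n) (seq (im z) n))
  (pointwise λ n → *-identity-im (seq (re z) n) (seq (im z) n))
  where open ComplexIdentities

ℂ-commutativeRing : CommutativeRing 0ℓ 0ℓ
ℂ-commutativeRing = record
  { Carrier = ℂ ; _≈_ = _≈_ ; _+_ = _+_ ; _*_ = _*_ ; -_ = -_ ; 0# = 0ℂ ; 1# = 1ℂ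
  ; isCommutativeRing = record
    { isRing = record
      { +-isAbelianGroup = record
        { isGroup = record
          { isMonoid = record
            { isSemigroup = record
              { isMagma = record { isEquivalence = isEquivalence ; ∙-cong = +-congᶜ }
              ; assoc = λ z w v → mk≈ℂ
                  (pointwise λ n → ℚ.+-assoc (seq (re z) n) (seq (re w) n) (seq (re v) n))
                  (pointwise λ n → ℚ.+-assoc (seq (im z) n) (seq (im w) n) (seq (im v) n))
              }
            ; identity = comm∧idˡ⇒id +-commᶜ λ z → mk≈ℂ
                (pointwise λ n → ℚ.+-identityˡ (seq (re z) n))
                (pointwise λ n → ℚ.+-identityˡ (seq (im z) n))
            }
          ; inverse = comm∧invˡ⇒inv +-commᶜ λ z → mk≈ℂ
              (pointwise λ n → ℚ.+-inverseˡ (seq (re z) n))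
              (pointwise λ n → ℚ.+-inverseˡ (seq (im z) n))
          ; ⁻¹-cong = λ p → mk≈ℂ (-ᴿ-cong (re≈ p)) (-ᴿ-cong (im≈ p))
          }
        ; comm = +-commᶜ
        }
      ; *-cong = λ p q → mk≈ℂ
          (+ᴿ-cong (*ᴿ-cong (re≈ p) (re≈ q)) (-ᴿ-cong (*ᴿ-cong (im≈ p) (im≈ q))))
          (+ᴿ-cong (*ᴿ-cong (re≈ p) (im≈ q)) (*ᴿ-cong (im≈ p) (re≈ q)))
      ; *-assoc = *-assocᶜ
      ; *-identity = comm∧idˡ⇒id *-commᶜ *-identityˡᶜ
      ; distrib = comm∧distrˡ⇒distr +-congᶜ *-commᶜ *-distribˡ-+ᶜ
      }
    ; *-comm = *-commᶜ
    }
  }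
  where
  open Setoid ≈-setoid using (isEquivalence)
  open Consequences ≈-setoid using (comm∧idˡ⇒id; comm∧invˡ⇒inv; comm∧distrˡ⇒distr)

-- The embedding of the rationals

ℚ⇒ℂ-cong : ∀ {p q} → p ≡ q → ℚ⇒ℂ p ≈ ℚ⇒ℂ q
ℚ⇒ℂ-cong ≡.refl = mk≈ℂ ≈ᴿ-refl ≈ᴿ-refl

ℝ⇒ℂ-homo-+ : ∀ x y → ℝ⇒ℂ (x +ᴿ y) ≈ ℝ⇒ℂ x + ℝ⇒ℂ y
ℝ⇒ℂ-homo-+ x y = mk≈ℂ ≈ᴿ-refl (pointwise λ _ → ≡.refl)

ℚ⇒ℂ-homo-+ : ∀ p q → ℚ⇒ℂ (p ℚ.+ q) ≈ ℚ⇒ℂ p + ℚ⇒ℂ q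
ℚ⇒ℂ-homo-+ p q = mk≈ℂ (pointwise λ _ → ≡.refl) (pointwise λ _ → ≡.refl)

ℚ⇒ℂ-homo-* : ∀ p q → ℚ⇒ℂ (p ℚ.* q) ≈ ℚ⇒ℂ p * ℚ⇒ℂ q
ℚ⇒ℂ-homo-* p q = mk≈ℂ
  (pointwise λ _ → solve 2 (λ p q → p :* q := p :* q :+ :- (con 0ℚ :* con 0ℚ)) ≡.refl p q)
  (pointwise λ _ → solve 2 (λ p q → con 0ℚ := p :* con 0ℚ :+ con 0ℚ :* q) ≡.refl p q)
  where open +-*-Solver

-- `ℚ._/_` reduces by a gcd, which is stuck on a variable numerator. In the unnormalised rationals
-- equality is cross-multiplication, and an identity of integers remains.
ℕ/1-homo-+ : ∀ m n → + (m ℕ.+ n) ℚ./ 1 ≡ (+ m ℚ./ 1) ℚ.+ (+ n ℚ./ 1)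
ℕ/1-homo-+ m n = ℚ.toℚᵘ-injective (begin
  ℚ.toℚᵘ (+ (m ℕ.+ n) ℚ./ 1)                        ≈⟨ ℚ.toℚᵘ-fromℚᵘ (mkℚᵘ (+ (m ℕ.+ n)) 0) ⟩
  mkℚᵘ (+ (m ℕ.+ n)) 0                              ≈⟨ *≡* (≡.cong (ℤ._* + 1) (≡.sym (≡.cong₂ ℤ._+_ (ℤ.*-identityʳ (+ m)) (ℤ.*-identityʳ (+ n))))) ⟩
  mkℚᵘ (+ m) 0 ℚᵘ.+ mkℚᵘ (+ n) 0                    ≈⟨ ℚᵘ.+-cong (ℚ.toℚᵘ-fromℚᵘ (mkℚᵘ (+ m) 0)) (ℚ.toℚᵘ-fromℚᵘ (mkℚᵘ (+ n) 0)) ⟨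
  ℚ.toℚᵘ (+ m ℚ./ 1) ℚᵘ.+ ℚ.toℚᵘ (+ n ℚ./ 1)        ≈⟨ ℚ.toℚᵘ-homo-+ (+ m ℚ./ 1) (+ n ℚ./ 1) ⟨
  ℚ.toℚᵘ ((+ m ℚ./ 1) ℚ.+ (+ n ℚ./ 1))              ∎)
  where open SetoidReasoning ℚᵘ.≃-setoid

ℕ/1-homo-* : ∀ m n → + (m ℕ.* n) ℚ./ 1 ≡ (+ m ℚ./ 1) ℚ.* (+ n ℚ./ 1)
ℕ/1-homo-* m n = ℚ.toℚᵘ-injective (begin
  ℚ.toℚᵘ (+ (m ℕ.* n) ℚ./ 1)                        ≈⟨ ℚ.toℚᵘ-fromℚᵘ (mkℚᵘ (+ (m ℕ.* n)) 0) ⟩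
  mkℚᵘ (+ (m ℕ.* n)) 0                              ≈⟨ *≡* (≡.cong (ℤ._* + 1) (ℤ.pos-* m n)) ⟩
  mkℚᵘ (+ m) 0 ℚᵘ.* mkℚᵘ (+ n) 0                    ≈⟨ ℚᵘ.*-cong (ℚ.toℚᵘ-fromℚᵘ (mkℚᵘ (+ m) 0)) (ℚ.toℚᵘ-fromℚᵘ (mkℚᵘ (+ n) 0)) ⟨
  ℚ.toℚᵘ (+ m ℚ./ 1) ℚᵘ.* ℚ.toℚᵘ (+ n ℚ./ 1)        ≈⟨ ℚ.toℚᵘ-homo-* (+ m ℚ./ 1) (+ n ℚ./ 1) ⟨
  ℚ.toℚᵘ ((+ m ℚ./ 1) ℚ.* (+ n ℚ./ 1))              ∎)
  where open SetoidReasoning ℚᵘ.≃-setoid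

n/1*1/n≡1 : ∀ n .{{_ : ℕ.NonZero n}} → (+ n ℚ./ 1) ℚ.* (+ 1 ℚ./ n) ≡ 1ℚ
n/1*1/n≡1 n@(suc n-1) = ℚ.toℚᵘ-injective (begin
  ℚ.toℚᵘ ((+ n ℚ./ 1) ℚ.* (+ 1 ℚ./ n))              ≈⟨ ℚ.toℚᵘ-homo-* (+ n ℚ./ 1) (+ 1 ℚ./ n) ⟩
  ℚ.toℚᵘ (+ n ℚ./ 1) ℚᵘ.* ℚ.toℚᵘ (+ 1 ℚ./ n)        ≈⟨ ℚᵘ.*-cong (ℚ.toℚᵘ-fromℚᵘ (mkℚᵘ (+ n) 0)) (ℚ.toℚᵘ-fromℚᵘ (mkℚᵘ (+ 1) n-1)) ⟩
  mkℚᵘ (+ n) 0 ℚᵘ.* mkℚᵘ (+ 1) n-1                  ≈⟨ *≡* (≡.trans (ℤ.*-assoc (+ n) (+ 1) (+ 1)) (≡.trans (ℤ.*-comm (+ n) (+ 1)) (≡.cong (λ k → + 1 ℤ.* + k) (≡.sym (ℕ.+-identityʳ n))))) ⟩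
  ℚᵘ.1ℚᵘ                                            ∎)
  where open SetoidReasoning ℚᵘ.≃-setoid

open CommutativeRing ℂ-commutativeRing
  using ( refl; sym; trans; reflexive; isEquivalence; setoid; semiring; commutativeSemiring; +-commutativeMonoid
        ; +-cong; +-congˡ; +-congʳ; +-assoc; +-comm; +-identityˡ; +-identityʳ; -‿cong; -‿inverseˡ; -‿inverseʳ
        ; *-cong; *-congˡ; *-congʳ; *-assoc; *-comm; *-identityˡ; *-identityʳ; distribʳ; zeroˡ; zeroʳ)
open SemiringSum semiring using (sum-cong-≋; sum-replicate-zero; *-distribˡ-sum; *-distribʳ-sum)
open NaturalSolver commutativeSemiring using (solve; _:+_; _:*_; _:=_; con)

-- Natural numbers and reciprocal factorials as complex numbers

ℕ⇒ℂ-homo-+ : ∀ m n → ℕ⇒ℂ (m ℕ.+ n) ≈ ℕ⇒ℂ m + ℕ⇒ℂ n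
ℕ⇒ℂ-homo-+ m n = trans (ℚ⇒ℂ-cong (ℕ/1-homo-+ m n)) (ℚ⇒ℂ-homo-+ _ _)

ℕ⇒ℂ-homo-* : ∀ m n → ℕ⇒ℂ (m ℕ.* n) ≈ ℕ⇒ℂ m * ℕ⇒ℂ n
ℕ⇒ℂ-homo-* m n = trans (ℚ⇒ℂ-cong (ℕ/1-homo-* m n)) (ℚ⇒ℂ-homo-* _ _)

n!*1/n!≈1 : ∀ n → ℕ⇒ℂ (n !) * 1/ n ! ≈ 1ℂ
n!*1/n!≈1 n = trans (sym (ℚ⇒ℂ-homo-* _ _)) (ℚ⇒ℂ-cong (n/1*1/n≡1 (n !) {{n ℕ.!≢0}}))

-- `nCk≡n!/k![n-k]!` gives a truncated quotient; that k! (n - k)! divides n! makes it exact.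
n!≡nCk*k![n∸k]! : ∀ {n k} → k ℕ.≤ n → n ! ≡ (n C k) ℕ.* (k ! ℕ.* (n ∸ k) !)
n!≡nCk*k![n∸k]! {n} {k} k≤n = ≡.sym (≡.trans
  (≡.cong (ℕ._* (k ! ℕ.* (n ∸ k) !)) (nCk≡n!/k![n-k]! k≤n))
  (ℕ.m/n*n≡m (≡.subst (ℕ._∣ n !) (ℕ.*-comm ((n ∸ k) !) (k !)) ([n∸k]!k!∣n! k≤n))))
  where instance _ = k ℕ.!* (n ∸ k) !≢0

suc*1/suc! : ∀ n → ℕ⇒ℂ (suc n) * 1/ suc n ! ≈ 1/ n !
suc*1/suc! n = begin
  ℕ⇒ℂ (suc n) * 1/ suc n !                              ≈⟨ *-identityʳ _ ⟨
  -- The factor 1 becomes n! · 1/n!, so that (n + 1) n! can cancel against 1/(n + 1)!.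
  ℕ⇒ℂ (suc n) * 1/ suc n ! * 1ℂ                         ≈⟨ *-congˡ (n!*1/n!≈1 n) ⟨
  ℕ⇒ℂ (suc n) * 1/ suc n ! * (ℕ⇒ℂ (n !) * 1/ n !)       ≈⟨ solve 4 (λ a b c d → a :* b :* (c :* d) := (a :* c) :* b :* d) refl
                                                             (ℕ⇒ℂ (suc n)) (1/ suc n !) (ℕ⇒ℂ (n !)) (1/ n !) ⟩
  (ℕ⇒ℂ (suc n) * ℕ⇒ℂ (n !)) * 1/ suc n ! * 1/ n !       ≈⟨ *-congʳ (*-congʳ (ℕ⇒ℂ-homo-* (suc n) (n !))) ⟨
  ℕ⇒ℂ (suc n !) * 1/ suc n ! * 1/ n !                   ≈⟨ *-congʳ (n!*1/n!≈1 (suc n)) ⟩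
  1ℂ * 1/ n !                                           ≈⟨ *-identityˡ _ ⟩
  1/ n !                                                ∎
  where open SetoidReasoning setoid

z-w+w≈z : ∀ z w → z - w + w ≈ z
z-w+w≈z z w = trans (+-assoc z (- w) w) (trans (+-congˡ (-‿inverseˡ w)) (+-identityʳ z))

-- Sums over an initial segment

∑-cong : ∀ n {f g} → (∀ j → j ℕ.≤ n → f j ≈ g j) → ∑≤ n f ≈ ∑≤ n g
∑-cong n eq = sum-cong-≋ {suc n} λ j → eq (toℕ j) (toℕ≤pred[n] j)

∑-distrib-+ : ∀ n f g → ∑[ j ≤ n ] (f j + g j) ≈ ∑≤ n f + ∑≤ n g
∑-distrib-+ n f g = MonoidSum.∑-distrib-+ +-commutativeMonoid {suc n} (λ j → f (toℕ j)) (λ j → g (toℕ j))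

*-distribˡ-∑ : ∀ n z f → z * ∑≤ n f ≈ ∑[ j ≤ n ] (z * f j)
*-distribˡ-∑ n z f = *-distribˡ-sum {suc n} z (λ j → f (toℕ j))

*-distribʳ-∑ : ∀ n z f → ∑≤ n f * z ≈ ∑[ j ≤ n ] (f j * z)
*-distribʳ-∑ n z f = *-distribʳ-sum {suc n} z (λ j → f (toℕ j))

∑-zero : ∀ n {f} → (∀ j → f j ≈ 0ℂ) → ∑≤ n f ≈ 0ℂ
∑-zero n eq = trans (∑-cong n λ j _ → eq j) (sum-replicate-zero (suc n))

∑-last : ∀ n f → ∑≤ (suc n) f ≈ ∑≤ n f + f (suc n)
∑-last zero    f = solve 2 (λ a b → a :+ (b :+ con 0) := (a :+ con 0) :+ b) refl (f 0) (f 1)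
∑-last (suc n) f = trans (+-congˡ (∑-last n (λ j → f (suc j)))) (sym (+-assoc _ _ _))

∑-reverse : ∀ n f → ∑≤ n f ≈ ∑[ j ≤ n ] f (n ∸ j)
∑-reverse zero    f = refl
∑-reverse (suc n) f = trans (∑-last n f) (trans (+-congʳ (∑-reverse n f)) (+-comm _ _))

-- The ring of formal power series

*ˢ-cong : ∀ {a a′ b b′} → a ≈ˢ a′ → b ≈ˢ b′ → (a *ˢ b) ≈ˢ (a′ *ˢ b′)
*ˢ-cong {a} {a′} {b} {b′} p q n =
  ∑-cong n {λ j → a j * b (n ∸ j)} {λ j → a′ j * b′ (n ∸ j)} λ j _ → *-cong (p j) (q (n ∸ j))

*ˢ-comm : ∀ a b → (a *ˢ b) ≈ˢ (b *ˢ a)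
*ˢ-comm a b n = begin
  ∑[ j ≤ n ] (a j * b (n ∸ j))
    ≈⟨ ∑-reverse n (λ j → a j * b (n ∸ j)) ⟩
  ∑[ j ≤ n ] (a (n ∸ j) * b (n ∸ (n ∸ j)))
    ≈⟨ ∑-cong n {λ j → a (n ∸ j) * b (n ∸ (n ∸ j))} {λ j → b j * a (n ∸ j)} (λ j j≤n →
         trans (*-congˡ (reflexive (≡.cong b (ℕ.m∸[m∸n]≡n j≤n)))) (*-comm (a (n ∸ j)) (b j))) ⟩
  ∑[ j ≤ n ] (b j * a (n ∸ j)) ∎
  where open SetoidReasoning setoid

·ˢ-*ˢ : ∀ z a b → ((z ·ˢ a) *ˢ b) ≈ˢ (z ·ˢ (a *ˢ b))
·ˢ-*ˢ z a b n = begin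
  ∑[ j ≤ n ] (z * a j * b (n ∸ j))
    ≈⟨ ∑-cong n {λ j → z * a j * b (n ∸ j)} {λ j → z * (a j * b (n ∸ j))} (λ j _ → *-assoc z (a j) (b (n ∸ j))) ⟩
  ∑[ j ≤ n ] (z * (a j * b (n ∸ j)))
    ≈⟨ *-distribˡ-∑ n z (λ j → a j * b (n ∸ j)) ⟨
  z * (∑[ j ≤ n ] (a j * b (n ∸ j))) ∎
  where open SetoidReasoning setoid

*ˢ-distribʳ-+ˢ : ∀ c a b → ((a +ˢ b) *ˢ c) ≈ˢ (a *ˢ c +ˢ b *ˢ c)
*ˢ-distribʳ-+ˢ c a b n = begin
  ∑[ j ≤ n ] ((a j + b j) * c (n ∸ j))
    ≈⟨ ∑-cong n {λ j → (a j + b j) * c (n ∸ j)} {λ j → a j * c (n ∸ j) + b j * c (n ∸ j)}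
         (λ j _ → distribʳ (c (n ∸ j)) (a j) (b j)) ⟩
  ∑[ j ≤ n ] (a j * c (n ∸ j) + b j * c (n ∸ j))
    ≈⟨ ∑-distrib-+ n (λ j → a j * c (n ∸ j)) (λ j → b j * c (n ∸ j)) ⟩
  (a *ˢ c) n + (b *ˢ c) n ∎
  where open SetoidReasoning setoid

constˢ-*ˢ : ∀ z a → (constˢ z *ˢ a) ≈ˢ (z ·ˢ a)
constˢ-*ˢ z a zero    = +-identityʳ _
constˢ-*ˢ z a (suc n) = trans
  (+-congˡ (∑-zero n {λ j → 0ℂ * a (n ∸ j)} λ j → zeroˡ (a (n ∸ j))))
  (+-identityʳ (z * a (suc n)))

-- Induction on the degree, through (a b)_(n+1) = a_0 b_(n+1) + (a′ b)_n with a′ the tail of a.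
*ˢ-assoc : ∀ a b c → (a *ˢ b *ˢ c) ≈ˢ (a *ˢ (b *ˢ c))
*ˢ-assoc a b c zero    =
  solve 3 (λ a b c → (a :* b :+ con 0) :* c :+ con 0 := a :* (b :* c :+ con 0) :+ con 0) refl (a 0) (b 0) (c 0)
*ˢ-assoc a b c (suc n) = begin
  (a 0 * b 0 + 0ℂ) * c (suc n) + ((a 0 ·ˢ b′ +ˢ a′ *ˢ b) *ˢ c) n
    ≈⟨ +-congˡ (trans (*ˢ-distribʳ-+ˢ c (a 0 ·ˢ b′) (a′ *ˢ b) n) (+-cong (·ˢ-*ˢ (a 0) b′ c n) (*ˢ-assoc a′ b c n))) ⟩
  (a 0 * b 0 + 0ℂ) * c (suc n) + (a 0 * (b′ *ˢ c) n + (a′ *ˢ (b *ˢ c)) n)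
    ≈⟨ solve 5 (λ a b c d e → (a :* b :+ con 0) :* c :+ (a :* d :+ e) := a :* (b :* c :+ d) :+ e) refl
         (a 0) (b 0) (c (suc n)) ((b′ *ˢ c) n) ((a′ *ˢ (b *ˢ c)) n) ⟩
  a 0 * (b 0 * c (suc n) + (b′ *ˢ c) n) + (a′ *ˢ (b *ˢ c)) n ∎
  where
  open SetoidReasoning setoid
  a′ b′ : Series
  a′ n = a (suc n)
  b′ n = b (suc n)

Series-commutativeRing : CommutativeRing 0ℓ 0ℓ
Series-commutativeRing = record
  { Carrier = Series ; _≈_ = _≈ˢ_ ; _+_ = _+ˢ_ ; _*_ = _*ˢ_ ; -_ = -ˢ_ ; 0# = constˢ 0ℂ ; 1# = constˢ 1ℂ
  ; isCommutativeRing = record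
    { isRing = record
      { +-isAbelianGroup = record
        { isGroup = record
          { isMonoid = record
            { isSemigroup = record
              { isMagma = record
                { isEquivalence = Setoid.isEquivalence ≈ˢ-setoid
                ; ∙-cong = λ p q n → +-cong (p n) (q n)
                }
              ; assoc = λ a b c n → +-assoc (a n) (b n) (c n)
              }
            ; identity = comm∧idˡ⇒id +ˢ-comm +ˢ-identityˡ
            }
          ; inverse = comm∧invˡ⇒inv +ˢ-comm +ˢ-inverseˡ
          ; ⁻¹-cong = λ p n → -‿cong (p n)
          }
        ; comm = +ˢ-comm
        }
      ; *-cong = *ˢ-cong
      ; *-assoc = *ˢ-assoc
      ; *-identity = comm∧idˡ⇒id *ˢ-comm λ a n → trans (constˢ-*ˢ 1ℂ a n) (*-identityˡ (a n))
      ; distrib = comm∧distrʳ⇒distr (λ p q n → +-cong (p n) (q n)) *ˢ-comm *ˢ-distribʳ-+ˢ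
      }
    ; *-comm = *ˢ-comm
    }
  }
  where
  ≈ˢ-setoid : Setoid 0ℓ 0ℓ
  ≈ˢ-setoid = record { isEquivalence = Pointwise.isEquivalence ℕ isEquivalence }
  open Consequences ≈ˢ-setoid using (comm∧idˡ⇒id; comm∧invˡ⇒inv; comm∧distrʳ⇒distr)
  +ˢ-comm : ∀ a b → (a +ˢ b) ≈ˢ (b +ˢ a)
  +ˢ-comm a b n = +-comm (a n) (b n)
  +ˢ-identityˡ : ∀ a → (constˢ 0ℂ +ˢ a) ≈ˢ a
  +ˢ-identityˡ a zero    = +-identityˡ _
  +ˢ-identityˡ a (suc n) = +-identityˡ _
  +ˢ-inverseˡ : ∀ a → (-ˢ a +ˢ a) ≈ˢ constˢ 0ℂ
  +ˢ-inverseˡ a zero    = -‿inverseˡ _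
  +ˢ-inverseˡ a (suc n) = -‿inverseˡ _

module Sᴿ = CommutativeRing Series-commutativeRing
open NaturalSolver Sᴿ.commutativeSemiring using ()
  renaming (solve to solveˢ; _:+_ to _⊕_; _:*_ to _⊗_; _:=_ to _⊜_; con to conˢ)

constˢ-cong : ∀ {z w} → z ≈ w → constˢ z ≈ˢ constˢ w
constˢ-cong z≈w zero    = z≈w
constˢ-cong z≈w (suc n) = refl

constˢ-homo-+ : ∀ z w → constˢ (z + w) ≈ˢ (constˢ z +ˢ constˢ w)
constˢ-homo-+ z w zero    = refl
constˢ-homo-+ z w (suc n) = sym (+-identityˡ 0ℂ)

-- Derivations of power series

-- These are t d/dt and d/dt. The second is the first shifted by one degree, so the product rule is
-- proved for `euler`, where the weights j and n - j add up to n, and then transported.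
euler deriv : Series → Series
euler a n = ℕ⇒ℂ n * a n
deriv a n = euler a (suc n)

euler-*ˢ : ∀ a b → euler (a *ˢ b) ≈ˢ (euler a *ˢ b +ˢ a *ˢ euler b)
euler-*ˢ a b n = begin
  ℕ⇒ℂ n * (∑[ j ≤ n ] (a j * b (n ∸ j)))
    ≈⟨ *-distribˡ-∑ n (ℕ⇒ℂ n) (λ j → a j * b (n ∸ j)) ⟩
  ∑[ j ≤ n ] (ℕ⇒ℂ n * (a j * b (n ∸ j)))
    ≈⟨ ∑-cong n {λ j → ℕ⇒ℂ n * (a j * b (n ∸ j))} {λ j → euler a j * b (n ∸ j) + a j * euler b (n ∸ j)} split ⟩
  ∑[ j ≤ n ] (euler a j * b (n ∸ j) + a j * euler b (n ∸ j))
    ≈⟨ ∑-distrib-+ n (λ j → euler a j * b (n ∸ j)) (λ j → a j * euler b (n ∸ j)) ⟩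
  (euler a *ˢ b) n + (a *ˢ euler b) n ∎
  where
  open SetoidReasoning setoid
  split : ∀ j → j ℕ.≤ n → ℕ⇒ℂ n * (a j * b (n ∸ j)) ≈ euler a j * b (n ∸ j) + a j * euler b (n ∸ j)
  split j j≤n = begin
    ℕ⇒ℂ n * (a j * b (n ∸ j))
      ≈⟨ *-congʳ (reflexive (≡.cong ℕ⇒ℂ (ℕ.m+[n∸m]≡n j≤n))) ⟨
    ℕ⇒ℂ (j ℕ.+ (n ∸ j)) * (a j * b (n ∸ j))
      ≈⟨ *-congʳ (ℕ⇒ℂ-homo-+ j (n ∸ j)) ⟩
    (ℕ⇒ℂ j + ℕ⇒ℂ (n ∸ j)) * (a j * b (n ∸ j))
      ≈⟨ solve 4 (λ p q a b → (p :+ q) :* (a :* b) := p :* a :* b :+ a :* (q :* b)) refl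
           (ℕ⇒ℂ j) (ℕ⇒ℂ (n ∸ j)) (a j) (b (n ∸ j)) ⟩
    euler a j * b (n ∸ j) + a j * euler b (n ∸ j) ∎

-- `euler a` has no constant term, and dividing it by t gives `deriv a`.
euler-*ˢ-suc : ∀ a b n → (euler a *ˢ b) (suc n) ≈ (deriv a *ˢ b) n
euler-*ˢ-suc a b n = trans (+-congʳ (trans (*-congʳ (zeroˡ (a 0))) (zeroˡ (b (suc n))))) (+-identityˡ _)

deriv-*ˢ : ∀ a b → deriv (a *ˢ b) ≈ˢ (deriv a *ˢ b +ˢ a *ˢ deriv b)
deriv-*ˢ a b n = begin
  euler (a *ˢ b) (suc n)                            ≈⟨ euler-*ˢ a b (suc n) ⟩
  (euler a *ˢ b) (suc n) + (a *ˢ euler b) (suc n)   ≈⟨ +-congˡ (*ˢ-comm a (euler b) (suc n)) ⟩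
  (euler a *ˢ b) (suc n) + (euler b *ˢ a) (suc n)   ≈⟨ +-cong (euler-*ˢ-suc a b n) (euler-*ˢ-suc b a n) ⟩
  (deriv a *ˢ b) n + (deriv b *ˢ a) n               ≈⟨ +-congˡ (*ˢ-comm (deriv b) a n) ⟩
  (deriv a *ˢ b) n + (a *ˢ deriv b) n               ∎
  where open SetoidReasoning setoid

-- Brings a recurrence stated without subtraction into the shape in which `fallingλ` recurs. The
-- solver works in the commutative semiring, so `- v` enters as an independent variable once v - v
-- has been inserted.
a+vb≈wb⇒a≈b[w-v] : ∀ {a v b w} → a + v * b ≈ w * b → a ≈ b * (w - v)
a+vb≈wb⇒a≈b[w-v] {a} {v} {b} {w} eq = begin
  a                       ≈⟨ +-identityʳ a ⟨
  a + 0ℂ                  ≈⟨ +-congˡ (trans (*-congʳ (-‿inverseʳ v)) (zeroˡ b)) ⟨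
  a + (v - v) * b         ≈⟨ solve 4 (λ a v b v′ → a :+ (v :+ v′) :* b := a :+ v :* b :+ v′ :* b) refl a v b (- v) ⟩
  a + v * b + - v * b     ≈⟨ +-congʳ eq ⟩
  w * b + - v * b         ≈⟨ solve 3 (λ w v′ b → w :* b :+ v′ :* b := b :* (w :+ v′)) refl w (- v) b ⟩
  b * (w - v)             ∎
  where open SetoidReasoning setoid

module _ (lam : ℝ) where

  -- (1 + λt) d/dt
  θ : Series → Series
  θ a = deriv a +ˢ constˢ (ℝ⇒ℂ lam) *ˢ euler a

  θ-coeff : ∀ a n → θ a n ≈ ℕ⇒ℂ (suc n) * a (suc n) + ℕ⇒ℂ n * ℝ⇒ℂ lam * a n
  θ-coeff a n = +-congˡ (trans (constˢ-*ˢ (ℝ⇒ℂ lam) (euler a) n)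
    (solve 3 (λ l m a → l :* (m :* a) := m :* l :* a) refl (ℝ⇒ℂ lam) (ℕ⇒ℂ n) (a n)))

  θ-cong : ∀ {a b} → a ≈ˢ b → θ a ≈ˢ θ b
  θ-cong {a} {b} p = Sᴿ.+-cong {deriv a} {deriv b} (λ n → *-congˡ (p (suc n)))
    (*ˢ-cong {constˢ (ℝ⇒ℂ lam)} Sᴿ.refl λ n → *-congˡ (p n))

  -- Since λ enters `θ` as a constant series, the product rules for `deriv` and `euler` combine by a
  -- semiring identity of series.
  θ-*ˢ : ∀ a b → θ (a *ˢ b) ≈ˢ (θ a *ˢ b +ˢ a *ˢ θ b)
  θ-*ˢ a b = begin
    deriv (a *ˢ b) +ˢ L *ˢ euler (a *ˢ b)
      ≈⟨ Sᴿ.+-cong {deriv (a *ˢ b)} (deriv-*ˢ a b) (*ˢ-cong {L} Sᴿ.refl (euler-*ˢ a b)) ⟩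
    deriv a *ˢ b +ˢ a *ˢ deriv b +ˢ L *ˢ (euler a *ˢ b +ˢ a *ˢ euler b)
      ≈⟨ solveˢ 7 (λ l a a′ a″ b b′ b″ →
           a′ ⊗ b ⊕ a ⊗ b′ ⊕ l ⊗ (a″ ⊗ b ⊕ a ⊗ b″) ⊜ (a′ ⊕ l ⊗ a″) ⊗ b ⊕ a ⊗ (b′ ⊕ l ⊗ b″))
           Sᴿ.refl L a (deriv a) (euler a) b (deriv b) (euler b) ⟩
    (deriv a +ˢ L *ˢ euler a) *ˢ b +ˢ a *ˢ (deriv b +ˢ L *ˢ euler b) ∎
    where
    open SetoidReasoning Sᴿ.setoid
    L = constˢ (ℝ⇒ℂ lam)

  θ-constˢ : ∀ z → θ (constˢ z) ≈ˢ constˢ 0ℂ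
  θ-constˢ z n = trans (θ-coeff (constˢ z) n) (trans (+-cong (zeroʳ _) (lower n)) (trans (+-identityˡ 0ℂ) (0≈ n)))
    where
    lower : ∀ n → ℕ⇒ℂ n * ℝ⇒ℂ lam * constˢ z n ≈ 0ℂ
    lower zero    = trans (*-congʳ (zeroˡ _)) (zeroˡ z)
    lower (suc n) = zeroʳ _
    0≈ : ∀ n → 0ℂ ≈ constˢ 0ℂ n
    0≈ zero    = refl
    0≈ (suc n) = refl

  θ-+ˢ : ∀ a b → θ (a +ˢ b) ≈ˢ (θ a +ˢ θ b)
  θ-+ˢ a b n = begin
    θ (a +ˢ b) n
      ≈⟨ θ-coeff (a +ˢ b) n ⟩
    ℕ⇒ℂ (suc n) * (a (suc n) + b (suc n)) + ℕ⇒ℂ n * ℝ⇒ℂ lam * (a n + b n)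
      ≈⟨ solve 6 (λ s v a′ b′ a b → s :* (a′ :+ b′) :+ v :* (a :+ b) := (s :* a′ :+ v :* a) :+ (s :* b′ :+ v :* b))
           refl (ℕ⇒ℂ (suc n)) (ℕ⇒ℂ n * ℝ⇒ℂ lam) (a (suc n)) (b (suc n)) (a n) (b n) ⟩
    (ℕ⇒ℂ (suc n) * a (suc n) + ℕ⇒ℂ n * ℝ⇒ℂ lam * a n) + (ℕ⇒ℂ (suc n) * b (suc n) + ℕ⇒ℂ n * ℝ⇒ℂ lam * b n)
      ≈⟨ +-cong (θ-coeff a n) (θ-coeff b n) ⟨
    θ a n + θ b n ∎
    where open SetoidReasoning setoid

  -- With c_n the coefficient of t^n in e_λ^z, the recursion of `fallingλ` gives (n + 1) c_(n+1) =
  -- (z - nλ) c_n; the term nλ c_n contributed by λt d/dt cancels the dependence on n.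
  θ-expλ : ∀ z → θ (expλ lam z) ≈ˢ (constˢ z *ˢ expλ lam z)
  θ-expλ z n = begin
    θ (expλ lam z) n
      ≈⟨ θ-coeff (expλ lam z) n ⟩
    ℕ⇒ℂ (suc n) * (f * (z - v) * 1/ suc n !) + v * (f * 1/ n !)
      ≈⟨ +-congʳ (solve 4 (λ s f w d → s :* (f :* w :* d) := f :* w :* (s :* d)) refl (ℕ⇒ℂ (suc n)) f (z - v) (1/ suc n !)) ⟩
    f * (z - v) * (ℕ⇒ℂ (suc n) * 1/ suc n !) + v * (f * 1/ n !)
      ≈⟨ +-congʳ (*-congˡ (suc*1/suc! n)) ⟩
    f * (z - v) * 1/ n ! + v * (f * 1/ n !)
      ≈⟨ solve 4 (λ f w d v → f :* w :* d :+ v :* (f :* d) := (w :+ v) :* (f :* d)) refl f (z - v) (1/ n !) v ⟩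
    (z - v + v) * (f * 1/ n !)
      ≈⟨ *-congʳ (z-w+w≈z z v) ⟩
    z * (f * 1/ n !)
      ≈⟨ constˢ-*ˢ z (expλ lam z) n ⟨
    (constˢ z *ˢ expλ lam z) n ∎
    where
    open SetoidReasoning setoid
    f = fallingλ lam z n
    v = ℕ⇒ℂ n * ℝ⇒ℂ lam

  expλ-1 : Series
  expλ-1 = expλ lam 1ℂ -ˢ constˢ 1ℂ

  expλ-1+1 : (expλ-1 +ˢ constˢ 1ℂ) ≈ˢ expλ lam 1ℂ
  expλ-1+1 n = z-w+w≈z (expλ lam 1ℂ n) (constˢ 1ℂ n)

  -- Adding the constant 1, which `θ` kills, reduces this to θ e_λ = e_λ.
  θ-expλ-1 : θ expλ-1 ≈ˢ (expλ-1 +ˢ constˢ 1ℂ)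
  θ-expλ-1 = begin
    θ expλ-1                              ≈⟨ Sᴿ.+-identityʳ (θ expλ-1) ⟨
    θ expλ-1 +ˢ constˢ 0ℂ                 ≈⟨ Sᴿ.+-congˡ {θ expλ-1} (θ-constˢ 1ℂ) ⟨
    θ expλ-1 +ˢ θ (constˢ 1ℂ)             ≈⟨ θ-+ˢ expλ-1 (constˢ 1ℂ) ⟨
    θ (expλ-1 +ˢ constˢ 1ℂ)               ≈⟨ θ-cong expλ-1+1 ⟩
    θ (expλ lam 1ℂ)                       ≈⟨ θ-expλ 1ℂ ⟩
    constˢ 1ℂ *ˢ expλ lam 1ℂ              ≈⟨ Sᴿ.*-identityˡ (expλ lam 1ℂ) ⟩
    expλ lam 1ℂ                           ≈⟨ expλ-1+1 ⟨
    expλ-1 +ˢ constˢ 1ℂ                   ∎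
    where open SetoidReasoning Sᴿ.setoid

  -- Recurrence, vanishing and falling-factorial sum of the degenerate λ-Stirling polynomials

  module _ (x : ℝ) where

    -- r! times the exponential generating function of S_{2,λ}^{(x)}(· , r)
    Q : ℕ → Series
    Q r = expλ-1 ^ˢ r *ˢ expλ lam (ℝ⇒ℂ x)

    -- The term r (e_λ - 1)^(r-1) e_λ^x of θ (Q r). The case r = 0 is set to 0 because the power r -
    -- 1 then has no meaning.
    r·Q[r-1] : ℕ → Series
    r·Q[r-1] zero    = constˢ 0ℂ
    r·Q[r-1] (suc r) = constˢ (ℕ⇒ℂ (suc r)) *ˢ Q r

    -- The extra factor e_λ - 1 raises the power back to r. Both sides vanish at r = 0, so the
    -- induction step of `θ-Q` covers r = 0 without a case split.
    expλ-1*r·Q[r-1] : ∀ r → (expλ-1 *ˢ r·Q[r-1] r) ≈ˢ (constˢ (ℕ⇒ℂ r) *ˢ Q r)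
    expλ-1*r·Q[r-1] zero    = Sᴿ.trans (Sᴿ.zeroʳ expλ-1) (Sᴿ.sym (Sᴿ.zeroˡ (Q 0)))
    expλ-1*r·Q[r-1] (suc r) = solveˢ 4 (λ q c p e → q ⊗ (c ⊗ (p ⊗ e)) ⊜ c ⊗ ((q ⊗ p) ⊗ e)) Sᴿ.refl
      expλ-1 (constˢ (ℕ⇒ℂ (suc r))) (expλ-1 ^ˢ r) (expλ lam (ℝ⇒ℂ x))

    -- Induction through Q (r+1) = (e_λ - 1) Q r and the product rule. The new factor yields Q (r+1)
    -- + Q r, the induction hypothesis (r + x) Q (r+1) + r Q r; the multipliers add up to r + 1 + x
    -- and r + 1.
    θ-Q : ∀ r → θ (Q r) ≈ˢ (constˢ (ℕ⇒ℂ r + ℝ⇒ℂ x) *ˢ Q r +ˢ r·Q[r-1] r)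
    θ-Q zero = begin
      θ (constˢ 1ℂ *ˢ e)                                      ≈⟨ θ-cong (Sᴿ.*-identityˡ e) ⟩
      θ e                                                     ≈⟨ θ-expλ (ℝ⇒ℂ x) ⟩
      constˢ (ℝ⇒ℂ x) *ˢ e                                     ≈⟨ *ˢ-cong (constˢ-cong (sym (+-identityˡ (ℝ⇒ℂ x)))) (Sᴿ.sym (Sᴿ.*-identityˡ e)) ⟩
      constˢ (0ℂ + ℝ⇒ℂ x) *ˢ (constˢ 1ℂ *ˢ e)                 ≈⟨ Sᴿ.+-identityʳ _ ⟨
      constˢ (0ℂ + ℝ⇒ℂ x) *ˢ (constˢ 1ℂ *ˢ e) +ˢ constˢ 0ℂ    ∎
      where
      open SetoidReasoning Sᴿ.setoid
      e = expλ lam (ℝ⇒ℂ x)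
    θ-Q (suc r) = begin
      θ (q *ˢ p *ˢ e)
        ≈⟨ θ-cong (*ˢ-assoc q p e) ⟩
      θ (q *ˢ Q r)
        ≈⟨ θ-*ˢ q (Q r) ⟩
      θ q *ˢ Q r +ˢ q *ˢ θ (Q r)
        ≈⟨ Sᴿ.+-cong {θ q *ˢ Q r} (*ˢ-cong {θ q} {b = Q r} θ-expλ-1 Sᴿ.refl) (*ˢ-cong {q} Sᴿ.refl (θ-Q r)) ⟩
      (q +ˢ constˢ 1ℂ) *ˢ Q r +ˢ q *ˢ (c *ˢ Q r +ˢ r·Q[r-1] r)
        ≈⟨ solveˢ 5 (λ q c p e s → (q ⊕ conˢ 1) ⊗ (p ⊗ e) ⊕ q ⊗ (c ⊗ (p ⊗ e) ⊕ s)
             ⊜ (conˢ 1 ⊕ c) ⊗ (q ⊗ p ⊗ e) ⊕ p ⊗ e ⊕ q ⊗ s) Sᴿ.refl q c p e (r·Q[r-1] r) ⟩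
      (constˢ 1ℂ +ˢ c) *ˢ Q (suc r) +ˢ Q r +ˢ q *ˢ r·Q[r-1] r
        ≈⟨ Sᴿ.+-congˡ {(constˢ 1ℂ +ˢ c) *ˢ Q (suc r) +ˢ Q r} (expλ-1*r·Q[r-1] r) ⟩
      (constˢ 1ℂ +ˢ c) *ˢ Q (suc r) +ˢ Q r +ˢ constˢ (ℕ⇒ℂ r) *ˢ Q r
        ≈⟨ solveˢ 4 (λ c s t d → (conˢ 1 ⊕ c) ⊗ s ⊕ t ⊕ d ⊗ t ⊜ (conˢ 1 ⊕ c) ⊗ s ⊕ (conˢ 1 ⊕ d) ⊗ t) Sᴿ.refl
             c (Q (suc r)) (Q r) (constˢ (ℕ⇒ℂ r)) ⟩
      (constˢ 1ℂ +ˢ c) *ˢ Q (suc r) +ˢ (constˢ 1ℂ +ˢ constˢ (ℕ⇒ℂ r)) *ˢ Q r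
        ≈⟨ Sᴿ.+-cong {(constˢ 1ℂ +ˢ c) *ˢ Q (suc r)}
             (*ˢ-cong {b = Q (suc r)} (Sᴿ.trans (Sᴿ.sym (constˢ-homo-+ 1ℂ (ℕ⇒ℂ r + ℝ⇒ℂ x))) (constˢ-cong 1+[r+x])) Sᴿ.refl)
             (*ˢ-cong {b = Q r} (Sᴿ.trans (Sᴿ.sym (constˢ-homo-+ 1ℂ (ℕ⇒ℂ r))) (constˢ-cong (sym (ℕ⇒ℂ-homo-+ 1 r)))) Sᴿ.refl) ⟩
      constˢ (ℕ⇒ℂ (suc r) + ℝ⇒ℂ x) *ˢ Q (suc r) +ˢ r·Q[r-1] (suc r) ∎
      where
      open SetoidReasoning Sᴿ.setoid
      q = expλ-1
      p = expλ-1 ^ˢ r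
      e = expλ lam (ℝ⇒ℂ x)
      c = constˢ (ℕ⇒ℂ r + ℝ⇒ℂ x)
      1+[r+x] : 1ℂ + (ℕ⇒ℂ r + ℝ⇒ℂ x) ≈ ℕ⇒ℂ (suc r) + ℝ⇒ℂ x
      1+[r+x] = trans (sym (+-assoc 1ℂ (ℕ⇒ℂ r) (ℝ⇒ℂ x))) (+-congʳ (sym (ℕ⇒ℂ-homo-+ 1 r)))

    S₂≈Q : ∀ m r → S₂ lam x m r ≈ ℕ⇒ℂ (m !) * 1/ r ! * Q r m
    S₂≈Q m r = trans (*-congˡ (·ˢ-*ˢ (1/ r !) (expλ-1 ^ˢ r) (expλ lam (ℝ⇒ℂ x)) m))
      (sym (*-assoc (ℕ⇒ℂ (m !)) (1/ r !) (Q r m)))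

    -- The convention S(m , -1) = 0 makes the recurrence uniform in r.
    S₂[_,_-1] : ℕ → ℕ → ℂ
    S₂[ m , zero -1]  = 0ℂ
    S₂[ m , suc r -1] = S₂ lam x m r

    r·Q[r-1]≈S₂ : ∀ m r → ℕ⇒ℂ (m !) * 1/ r ! * r·Q[r-1] r m ≈ S₂[ m , r -1]
    r·Q[r-1]≈S₂ m zero    = trans (*-congˡ (0≈ m)) (zeroʳ _)
      where
      0≈ : ∀ m → constˢ 0ℂ m ≈ 0ℂ
      0≈ zero    = refl
      0≈ (suc m) = refl
    r·Q[r-1]≈S₂ m (suc r) = begin
      ℕ⇒ℂ (m !) * 1/ suc r ! * (constˢ (ℕ⇒ℂ (suc r)) *ˢ Q r) m
        ≈⟨ *-congˡ (constˢ-*ˢ (ℕ⇒ℂ (suc r)) (Q r) m) ⟩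
      ℕ⇒ℂ (m !) * 1/ suc r ! * (ℕ⇒ℂ (suc r) * Q r m)
        ≈⟨ solve 4 (λ a b c d → a :* b :* (c :* d) := a :* (c :* b) :* d) refl
             (ℕ⇒ℂ (m !)) (1/ suc r !) (ℕ⇒ℂ (suc r)) (Q r m) ⟩
      ℕ⇒ℂ (m !) * (ℕ⇒ℂ (suc r) * 1/ suc r !) * Q r m
        ≈⟨ *-congʳ (*-congˡ (suc*1/suc! r)) ⟩
      ℕ⇒ℂ (m !) * 1/ r ! * Q r m
        ≈⟨ S₂≈Q m r ⟨
      S₂ lam x m r ∎
      where open SetoidReasoning setoid

    -- The coefficient of t^m in `θ-Q` times m! / r!, with (m + 1) m! = (m + 1)! producing S(m+1 ,
    -- r). The λ-term stays on the left to avoid subtraction.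
    S₂-recurrence : ∀ m r → S₂ lam x (suc m) r + ℕ⇒ℂ m * ℝ⇒ℂ lam * S₂ lam x m r
      ≈ (ℕ⇒ℂ r + ℝ⇒ℂ x) * S₂ lam x m r + S₂[ m , r -1]
    S₂-recurrence m r = begin
      S₂ lam x (suc m) r + v * S₂ lam x m r
        ≈⟨ +-cong (S₂≈Q (suc m) r) (*-congˡ (S₂≈Q m r)) ⟩
      ℕ⇒ℂ (suc m !) * d * Q r (suc m) + v * (ℕ⇒ℂ (m !) * d * Q r m)
        ≈⟨ +-congʳ (*-congʳ (*-congʳ (ℕ⇒ℂ-homo-* (suc m) (m !)))) ⟩
      ℕ⇒ℂ (suc m) * ℕ⇒ℂ (m !) * d * Q r (suc m) + v * (ℕ⇒ℂ (m !) * d * Q r m)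
        ≈⟨ solve 6 (λ s f d q′ v q → s :* f :* d :* q′ :+ v :* (f :* d :* q) := f :* d :* (s :* q′ :+ v :* q)) refl
             (ℕ⇒ℂ (suc m)) (ℕ⇒ℂ (m !)) d (Q r (suc m)) v (Q r m) ⟩
      ℕ⇒ℂ (m !) * d * (ℕ⇒ℂ (suc m) * Q r (suc m) + v * Q r m)
        ≈⟨ *-congˡ (trans (sym (θ-coeff (Q r) m)) (θ-Q r m)) ⟩
      ℕ⇒ℂ (m !) * d * ((constˢ w *ˢ Q r) m + r·Q[r-1] r m)
        ≈⟨ *-congˡ (+-congʳ (constˢ-*ˢ w (Q r) m)) ⟩
      ℕ⇒ℂ (m !) * d * (w * Q r m + r·Q[r-1] r m)
        ≈⟨ solve 5 (λ f d w q s → f :* d :* (w :* q :+ s) := w :* (f :* d :* q) :+ f :* d :* s) refl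
             (ℕ⇒ℂ (m !)) d w (Q r m) (r·Q[r-1] r m) ⟩
      w * (ℕ⇒ℂ (m !) * d * Q r m) + ℕ⇒ℂ (m !) * d * r·Q[r-1] r m
        ≈⟨ +-cong (*-congˡ (sym (S₂≈Q m r))) (r·Q[r-1]≈S₂ m r) ⟩
      w * S₂ lam x m r + S₂[ m , r -1] ∎
      where
      open SetoidReasoning setoid
      v = ℕ⇒ℂ m * ℝ⇒ℂ lam
      d = 1/ r !
      w = ℕ⇒ℂ r + ℝ⇒ℂ x

    Q[0,0]≈1 : Q 0 0 ≈ 1ℂ
    Q[0,0]≈1 = trans (Sᴿ.*-identityˡ (expλ lam (ℝ⇒ℂ x)) 0) (*-identityˡ 1ℂ)

    S₂[0,0]≈1 : S₂ lam x 0 0 ≈ 1ℂ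
    S₂[0,0]≈1 = trans (S₂≈Q 0 0) (trans (*-cong (*-identityˡ 1ℂ) Q[0,0]≈1) (*-identityˡ 1ℂ))

    -- Induction on m: the recurrence expresses S(m+1 , r+1) through S(m , r+1) and S(m , r), both
    -- already zero. The base case is the vanishing constant term of e_λ - 1.
    m<r⇒S₂≈0 : ∀ {m r} → m ℕ.< r → S₂ lam x m r ≈ 0ℂ
    m<r⇒S₂≈0 {zero}  {suc r} _ = trans (S₂≈Q 0 (suc r)) (trans (*-congˡ Q[suc,0]≈0) (zeroʳ _))
      where
      expλ-1[0]≈0 : expλ-1 0 ≈ 0ℂ
      expλ-1[0]≈0 = trans (+-congʳ (*-identityˡ 1ℂ)) (-‿inverseʳ 1ℂ)
      Q[suc,0]≈0 : Q (suc r) 0 ≈ 0ℂ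
      Q[suc,0]≈0 = begin
        (expλ-1 0 * p + 0ℂ) * e + 0ℂ   ≈⟨ +-congʳ (*-congʳ (+-congʳ (*-congʳ expλ-1[0]≈0))) ⟩
        (0ℂ * p + 0ℂ) * e + 0ℂ         ≈⟨ solve 2 (λ p e → (con 0 :* p :+ con 0) :* e :+ con 0 := con 0) refl p e ⟩
        0ℂ                             ∎
        where
        open SetoidReasoning setoid
        p = (expλ-1 ^ˢ r) 0
        e = expλ lam (ℝ⇒ℂ x) 0
    m<r⇒S₂≈0 {suc m} {suc r} (s≤s m<r) = begin
      S₂ lam x (suc m) (suc r)
        ≈⟨ solve 2 (λ s v → s := s :+ v :* con 0) refl (S₂ lam x (suc m) (suc r)) (ℕ⇒ℂ m * ℝ⇒ℂ lam) ⟩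
      S₂ lam x (suc m) (suc r) + ℕ⇒ℂ m * ℝ⇒ℂ lam * 0ℂ
        ≈⟨ +-congˡ (*-congˡ (m<r⇒S₂≈0 (ℕ.m<n⇒m<1+n m<r))) ⟨
      S₂ lam x (suc m) (suc r) + ℕ⇒ℂ m * ℝ⇒ℂ lam * S₂ lam x m (suc r)
        ≈⟨ S₂-recurrence m (suc r) ⟩
      (ℕ⇒ℂ (suc r) + ℝ⇒ℂ x) * S₂ lam x m (suc r) + S₂ lam x m r
        ≈⟨ +-cong (*-congˡ (m<r⇒S₂≈0 (ℕ.m<n⇒m<1+n m<r))) (m<r⇒S₂≈0 m<r) ⟩
      (ℕ⇒ℂ (suc r) + ℝ⇒ℂ x) * 0ℂ + 0ℂ
        ≈⟨ trans (+-identityʳ _) (zeroʳ _) ⟩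
      0ℂ ∎
      where open SetoidReasoning setoid

    ∑-S₂-falling : ∀ z m → ∑[ r ≤ m ] (S₂ lam x m r * falling z r) ≈ fallingλ lam (ℝ⇒ℂ x + z) m
    ∑-S₂-falling z zero    = trans (+-identityʳ _) (trans (*-identityʳ _) S₂[0,0]≈1)
    -- `step` reads A_(m+1) + v A_m = (x + z) A_m, and A_m (x + z - v) matches the defining clause
    -- of `fallingλ`.
    ∑-S₂-falling z (suc m) = trans (a+vb≈wb⇒a≈b[w-v] step) (*-congʳ (∑-S₂-falling z m))
      where
      open SetoidReasoning setoid
      v = ℕ⇒ℂ m * ℝ⇒ℂ lam
      s s′ f g : ℕ → ℂ
      s r  = S₂ lam x m r
      s′ r = S₂ lam x (suc m) r
      f    = falling z
      g r  = (ℕ⇒ℂ r + ℝ⇒ℂ x) * s r * f r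

      drop-last : ∀ h → h (suc m) ≈ 0ℂ → ∑≤ (suc m) h ≈ ∑≤ m h
      drop-last h h≈0 = trans (∑-last m h) (trans (+-congˡ h≈0) (+-identityʳ _))

      s[suc-m]≈0 : s (suc m) ≈ 0ℂ
      s[suc-m]≈0 = m<r⇒S₂≈0 (ℕ.n<1+n m)

      -- Here r cancels: r + x from the recurrence meets z - r from the next falling factor, leaving
      -- a multiplier that can leave the sum.
      collect : ∀ r → g r + s r * f (suc r) ≈ (ℝ⇒ℂ x + z) * (s r * f r)
      collect r = begin
        (ℕ⇒ℂ r + ℝ⇒ℂ x) * s r * f r + s r * (f r * (z - ℕ⇒ℂ r))
          ≈⟨ solve 5 (λ r x s f w → (r :+ x) :* s :* f :+ s :* (f :* w) := (x :+ (w :+ r)) :* (s :* f)) refl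
               (ℕ⇒ℂ r) (ℝ⇒ℂ x) (s r) (f r) (z - ℕ⇒ℂ r) ⟩
        (ℝ⇒ℂ x + (z - ℕ⇒ℂ r + ℕ⇒ℂ r)) * (s r * f r)
          ≈⟨ *-congʳ (+-congˡ (z-w+w≈z z (ℕ⇒ℂ r))) ⟩
        (ℝ⇒ℂ x + z) * (s r * f r) ∎

      recur : ∀ r → s′ r * f r + v * (s r * f r) ≈ g r + S₂[ m , r -1] * f r
      recur r = begin
        s′ r * f r + v * (s r * f r)
          ≈⟨ solve 4 (λ a f v b → a :* f :+ v :* (b :* f) := (a :+ v :* b) :* f) refl (s′ r) (f r) v (s r) ⟩
        (s′ r + v * s r) * f r
          ≈⟨ *-congʳ (S₂-recurrence m r) ⟩
        ((ℕ⇒ℂ r + ℝ⇒ℂ x) * s r + S₂[ m , r -1]) * f r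
          ≈⟨ distribʳ (f r) _ _ ⟩
        g r + S₂[ m , r -1] * f r ∎

      step : ∑≤ (suc m) (λ r → s′ r * f r) + v * ∑≤ m (λ r → s r * f r) ≈ (ℝ⇒ℂ x + z) * ∑≤ m (λ r → s r * f r)
      step = begin
        ∑≤ (suc m) (λ r → s′ r * f r) + v * ∑≤ m (λ r → s r * f r)
          -- S(m , m+1) = 0 extends the second sum to the range of the first, so that they add
          -- termwise.
          ≈⟨ +-congˡ (*-congˡ (drop-last (λ r → s r * f r) (trans (*-congʳ s[suc-m]≈0) (zeroˡ _)))) ⟨
        ∑≤ (suc m) (λ r → s′ r * f r) + v * ∑≤ (suc m) (λ r → s r * f r)
          ≈⟨ +-congˡ (*-distribˡ-∑ (suc m) v (λ r → s r * f r)) ⟩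
        ∑≤ (suc m) (λ r → s′ r * f r) + ∑≤ (suc m) (λ r → v * (s r * f r))
          ≈⟨ ∑-distrib-+ (suc m) (λ r → s′ r * f r) (λ r → v * (s r * f r)) ⟨
        ∑≤ (suc m) (λ r → s′ r * f r + v * (s r * f r))
          ≈⟨ ∑-cong (suc m) {λ r → s′ r * f r + v * (s r * f r)} {λ r → g r + S₂[ m , r -1] * f r} (λ r _ → recur r) ⟩
        ∑≤ (suc m) (λ r → g r + S₂[ m , r -1] * f r)
          ≈⟨ ∑-distrib-+ (suc m) g (λ r → S₂[ m , r -1] * f r) ⟩
        -- `∑≤` unfolds at its first term: the term r = 0 is 0 by the convention for S(m , -1), and
        -- the others appear already reindexed from r - 1 to r.
        ∑≤ (suc m) g + (0ℂ * f 0 + ∑≤ m (λ r → s r * f (suc r)))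
          ≈⟨ +-cong (drop-last g (trans (*-congʳ (trans (*-congˡ s[suc-m]≈0) (zeroʳ _))) (zeroˡ _)))
                    (trans (+-congʳ (zeroˡ (f 0))) (+-identityˡ _)) ⟩
        ∑≤ m g + ∑≤ m (λ r → s r * f (suc r))
          ≈⟨ ∑-distrib-+ m g (λ r → s r * f (suc r)) ⟨
        ∑≤ m (λ r → g r + s r * f (suc r))
          ≈⟨ ∑-cong m {λ r → g r + s r * f (suc r)} {λ r → (ℝ⇒ℂ x + z) * (s r * f r)} (λ r _ → collect r) ⟩
        ∑≤ m (λ r → (ℝ⇒ℂ x + z) * (s r * f r))
          ≈⟨ *-distribˡ-∑ m (ℝ⇒ℂ x + z) (λ r → s r * f r) ⟨
        (ℝ⇒ℂ x + z) * ∑≤ m (λ r → s r * f r) ∎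

  -- Coefficients of e_λ^z, binomial convolution and the addition formula

  fallingλ-cong : ∀ {z w} → z ≈ w → ∀ n → fallingλ lam z n ≈ fallingλ lam w n
  fallingλ-cong z≈w zero    = refl
  fallingλ-cong z≈w (suc n) = *-cong (fallingλ-cong z≈w n) (+-congʳ z≈w)

  egfCoeff-expλ : ∀ z n → egfCoeff (expλ lam z) n ≈ fallingλ lam z n
  egfCoeff-expλ z n = begin
    ℕ⇒ℂ (n !) * (fallingλ lam z n * 1/ n !)
      ≈⟨ solve 3 (λ a b c → a :* (b :* c) := b :* (a :* c)) refl (ℕ⇒ℂ (n !)) (fallingλ lam z n) (1/ n !) ⟩
    fallingλ lam z n * (ℕ⇒ℂ (n !) * 1/ n !)
      ≈⟨ *-congˡ (n!*1/n!≈1 n) ⟩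
    fallingλ lam z n * 1ℂ
      ≈⟨ *-identityʳ _ ⟩
    fallingλ lam z n ∎
    where open SetoidReasoning setoid

  -- For n ≥ 1 the product (0)_{n,λ} contains the factor 0. This trivialises the exponential in the
  -- series of FG(0 , y).
  expλ0≈1 : expλ lam 0ℂ ≈ˢ constˢ 1ℂ
  expλ0≈1 zero    = *-identityˡ 1ℂ
  expλ0≈1 (suc n) = trans (*-congʳ (fallingλ0≈0 n)) (zeroˡ _)
    where
    fallingλ0≈0 : ∀ n → fallingλ lam 0ℂ (suc n) ≈ 0ℂ
    fallingλ0≈0 zero    = trans (*-identityˡ _) (trans (+-congˡ (-‿cong (zeroˡ _))) (-‿inverseʳ 0ℂ))
    fallingλ0≈0 (suc n) = trans (*-congʳ (fallingλ0≈0 n)) (zeroˡ _)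

-- In the m-th term n! splits as C(n , m) m! (n - m)!, and the two smaller factorials normalise the
-- two coefficients.
egfCoeff-*ˢ : ∀ a b n → egfCoeff (a *ˢ b) n ≈ ∑[ m ≤ n ] (ℕ⇒ℂ (n C m) * (egfCoeff a m * egfCoeff b (n ∸ m)))
egfCoeff-*ˢ a b n = begin
  ℕ⇒ℂ (n !) * (∑[ m ≤ n ] (a m * b (n ∸ m)))
    ≈⟨ *-distribˡ-∑ n (ℕ⇒ℂ (n !)) (λ m → a m * b (n ∸ m)) ⟩
  ∑[ m ≤ n ] (ℕ⇒ℂ (n !) * (a m * b (n ∸ m)))
    ≈⟨ ∑-cong n {λ m → ℕ⇒ℂ (n !) * (a m * b (n ∸ m))} {λ m → ℕ⇒ℂ (n C m) * (egfCoeff a m * egfCoeff b (n ∸ m))} split ⟩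
  ∑[ m ≤ n ] (ℕ⇒ℂ (n C m) * (egfCoeff a m * egfCoeff b (n ∸ m))) ∎
  where
  open SetoidReasoning setoid
  split : ∀ m → m ℕ.≤ n → ℕ⇒ℂ (n !) * (a m * b (n ∸ m)) ≈ ℕ⇒ℂ (n C m) * (egfCoeff a m * egfCoeff b (n ∸ m))
  split m m≤n = begin
    ℕ⇒ℂ (n !) * (a m * b (n ∸ m))
      ≈⟨ *-congʳ (reflexive (≡.cong ℕ⇒ℂ (n!≡nCk*k![n∸k]! m≤n))) ⟩
    ℕ⇒ℂ ((n C m) ℕ.* (m ! ℕ.* (n ∸ m) !)) * (a m * b (n ∸ m))
      ≈⟨ *-congʳ (trans (ℕ⇒ℂ-homo-* (n C m) (m ! ℕ.* (n ∸ m) !)) (*-congˡ (ℕ⇒ℂ-homo-* (m !) ((n ∸ m) !)))) ⟩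
    ℕ⇒ℂ (n C m) * (ℕ⇒ℂ (m !) * ℕ⇒ℂ ((n ∸ m) !)) * (a m * b (n ∸ m))
      ≈⟨ solve 5 (λ c p q a b → c :* (p :* q) :* (a :* b) := c :* ((p :* a) :* (q :* b))) refl
           (ℕ⇒ℂ (n C m)) (ℕ⇒ℂ (m !)) (ℕ⇒ℂ ((n ∸ m) !)) (a m) (b (n ∸ m)) ⟩
    ℕ⇒ℂ (n C m) * (egfCoeff a m * egfCoeff b (n ∸ m)) ∎

-- Variable `K` and `H` make cosine and sine two instances. The factor `expλ lam 0ℂ` is kept on the
-- right because FG(0 , y) unfolds to a series containing it.
egfCoeff-addition : ∀ lam x₁ x₂ K H n →
  egfCoeff (K *ˢ expλ lam (ℝ⇒ℂ (x₁ +ᴿ x₂)) *ˢ H) n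
  ≈ ∑[ m ≤ n ] (ℕ⇒ℂ (n C m) * (∑[ r ≤ m ] (S₂ lam x₁ m r * falling (ℝ⇒ℂ x₂) r
      * egfCoeff (K *ˢ expλ lam 0ℂ *ˢ H) (n ∸ m))))
egfCoeff-addition lam x₁ x₂ K H n = begin
  egfCoeff (K *ˢ e *ˢ H) n
    ≈⟨ *-congˡ (rearrange n) ⟩
  egfCoeff (e *ˢ G) n
    ≈⟨ egfCoeff-*ˢ e G n ⟩
  ∑[ m ≤ n ] (ℕ⇒ℂ (n C m) * (egfCoeff e m * egfCoeff G (n ∸ m)))
    ≈⟨ ∑-cong n {λ m → ℕ⇒ℂ (n C m) * (egfCoeff e m * egfCoeff G (n ∸ m))}
         {λ m → ℕ⇒ℂ (n C m) * (∑[ r ≤ m ] (S₂ lam x₁ m r * falling (ℝ⇒ℂ x₂) r * egfCoeff G (n ∸ m)))}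
         (λ m _ → *-congˡ (trans (*-congʳ (expand m))
           (*-distribʳ-∑ m (egfCoeff G (n ∸ m)) (λ r → S₂ lam x₁ m r * falling (ℝ⇒ℂ x₂) r)))) ⟩
  ∑[ m ≤ n ] (ℕ⇒ℂ (n C m) * (∑[ r ≤ m ] (S₂ lam x₁ m r * falling (ℝ⇒ℂ x₂) r * egfCoeff G (n ∸ m)))) ∎
  where
  open SetoidReasoning setoid
  e = expλ lam (ℝ⇒ℂ (x₁ +ᴿ x₂))
  G = K *ˢ expλ lam 0ℂ *ˢ H

  rearrange : (K *ˢ e *ˢ H) ≈ˢ (e *ˢ G)
  rearrange = Sᴿ.trans
    (solveˢ 3 (λ k e h → k ⊗ e ⊗ h ⊜ e ⊗ (k ⊗ conˢ 1 ⊗ h)) Sᴿ.refl K e H)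
    (*ˢ-cong {e} Sᴿ.refl (*ˢ-cong {b = H} (*ˢ-cong {K} Sᴿ.refl (Sᴿ.sym (expλ0≈1 lam))) Sᴿ.refl))

  expand : ∀ m → egfCoeff e m ≈ ∑[ r ≤ m ] (S₂ lam x₁ m r * falling (ℝ⇒ℂ x₂) r)
  expand m = trans (egfCoeff-expλ lam (ℝ⇒ℂ (x₁ +ᴿ x₂)) m)
    -- The embedded sum and the sum of the embeddings have imaginary parts `0ℝ` and `0ℝ +ᴿ 0ℝ`, so
    -- they agree only up to `_≈_`.
    (trans (fallingλ-cong lam (ℝ⇒ℂ-homo-+ x₁ x₂) m) (sym (∑-S₂-falling lam x₁ (ℝ⇒ℂ x₂) m)))

theorem6 : (lam : ℝ) (lam#0 : lam #ᴿ 0ℝ) (k : ℤ) (u : ℂ) (u#1 : u # 1ℂ) (x₁ x₂ y : ℝ) (n : ℕ) →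
    (FGᶜ k lam lam#0 u u#1 n (x₁ +ᴿ x₂) y
    ≈ (∑[ m ≤ n ] (ℕ⇒ℂ (n C m) * (∑[ r ≤ m ] (S₂ lam x₁ m r * falling (ℝ⇒ℂ x₂) r * FGᶜ k lam lam#0 u u#1 (n ∸ m) 0ℝ y)))))
    × (FGˢ k lam lam#0 u u#1 n (x₁ +ᴿ x₂) y
    ≈ (∑[ m ≤ n ] (ℕ⇒ℂ (n C m) * (∑[ r ≤ m ] (S₂ lam x₁ m r * falling (ℝ⇒ℂ x₂) r * FGˢ k lam lam#0 u u#1 (n ∸ m) 0ℝ y)))))
theorem6 lam lam#0 k u u#1 x₁ x₂ y n =
    egfCoeff-addition lam x₁ x₂ (FG-kernel k lam lam#0 u u#1) (cosλ lam y) n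
  , egfCoeff-addition lam x₁ x₂ (FG-kernel k lam lam#0 u u#1) (sinλ lam y) n
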